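{- Suppose $2^{\aleph_0} > \aleph_1 = \mathrm{cf}(2^{\aleph_0})$ and $\mathrm{Cov}(\mathrm{meagre}) = 2^{\aleph_0}$. If $\mathbf{M}, \mathbf{N}$ are structures of size $\aleph_1$ in the same countable first-order language and $\mathbf{M} \equiv \mathbf{N}$, then $\mathbf{M}^{\omega}/\mathcal{U} \simeq \mathbf{N}^{\omega}/\mathcal{U}$ for some ultrafilter $\mathcal{U}$ on $\omega$.
   Context: The ambient theory is ZFC. $\mathrm{Cov}(\mathrm{meagre})$ is the minimal size of a family of meagre subsets of the real line whose union is the whole real line. $\mathrm{cf}$ denotes cofinality. The size of a structure is the cardinality of its universe. $\mathbf{M} \equiv \mathbf{N}$ denotes elementary equivalence, $\mathbf{M}^{\omega}/\mathcal{U}$ denotes the ultrapower of $\mathbf{M}$ by the ultrafilter $\mathcal{U}$ on $\omega$, and $\simeq$ denotes isomorphism of structures. -}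

module Defs where

open import Level using (Level; 0ℓ; suc; _⊔_)
open import Data.Bool.Base using (Bool)
open import Data.Fin.Base using (Fin)
open import Data.Nat.Base as ℕ using (ℕ)
open import Data.Product.Base using (Σ-syntax; ∃-syntax; _×_; _,_; proj₁; proj₂)
open import Data.Rational.Base as ℚ using (ℚ)
open import Data.Sum.Base using (_⊎_)
open import Data.Vec.Base as Vec using (Vec; []; _∷_; lookup)
open import Data.Vec.Relation.Binary.Pointwise.Inductive
  using (Pointwise; []; _∷_)
open import Function.Bundles using (Func; Injection; Bijection; _⇔_; _↣_)
open import Induction.WellFounded using (WellFounded)
open import Relation.Binary.Bundles using (Setoid; StrictTotalOrder)
open import Relation.Binary.Definitions using (_Respects_)
open import Relation.Binary.PropositionalEquality as ≡ using (_→-setoid_)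
import Relation.Binary.Construct.On as On
open import Relation.Nullary.Negation.Core using (¬_)
open import Relation.Unary using (Pred; _≐_; _⊆_; _∩_; ∁; ∅; U; Empty; ⋃)
open import Relation.Unary.Properties using (≐-refl; ≐-sym; ≐-trans)

private
  variable
    a b c ℓ ℓ₁ ℓ₂ p : Level

-- Sets are represented by setoids, with the setoid equality playing the role
-- of equality.  Given excluded middle at every level and the axiom of choice
-- below, it is no restriction that predicates are Set-valued.

-- The axiom of choice for setoids.  The point is that the choice function
-- must respect the equality of S; without this requirement the axiom would be
-- provable.
AxiomOfChoice : ∀ a ℓ₁ b ℓ₂ r → Set (suc (a ⊔ ℓ₁ ⊔ b ⊔ ℓ₂ ⊔ r))
AxiomOfChoice a ℓ₁ b ℓ₂ r =
  (S : Setoid a ℓ₁) (T : Setoid b ℓ₂) →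
  (R : Setoid.Carrier S → Setoid.Carrier T → Set r) →
  (∀ {x x′ y y′} → Setoid._≈_ S x x′ → Setoid._≈_ T y y′ → R x y → R x′ y′) →
  (∀ x → ∃[ y ] R x y) →
  Σ[ f ∈ Func S T ] (∀ x → R x (Func.to f x))

------------------------------------------------------------------------
-- Subsets and power sets

record Subset (S : Setoid a ℓ) : Set (suc 0ℓ ⊔ a ⊔ ℓ) where
  open Setoid S
  field
    Mem  : Pred Carrier 0ℓ
    resp : Mem Respects _≈_

open Subset public using (Mem)

ℙ : Setoid a ℓ → Setoid (suc 0ℓ ⊔ a ⊔ ℓ) a
ℙ S = record
  { Carrier       = Subset S
  ; _≈_           = λ A B → Mem A ≐ Mem B
  ; isEquivalence = record { refl = ≐-refl ; sym = ≐-sym ; trans = ≐-trans }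
  }

⟪_⟫ : {S : Setoid a ℓ} → Subset S → Setoid a ℓ
⟪_⟫ {S = S} A = On.setoid S (proj₁ {B = Mem A})

------------------------------------------------------------------------
-- Cardinality

-- The cardinality of a set is handled through the comparison relations
-- |A| ≤ |B|, |A| = |B| and |A| < |B|.

infix 4 _≤ᶜ_ _≈ᶜ_ _<ᶜ_

_≤ᶜ_ : Setoid a ℓ₁ → Setoid b ℓ₂ → Set (a ⊔ ℓ₁ ⊔ b ⊔ ℓ₂)
A ≤ᶜ B = Injection A B

_≈ᶜ_ : Setoid a ℓ₁ → Setoid b ℓ₂ → Set (a ⊔ ℓ₁ ⊔ b ⊔ ℓ₂)
A ≈ᶜ B = Bijection A B

_<ᶜ_ : Setoid a ℓ₁ → Setoid b ℓ₂ → Set (a ⊔ ℓ₁ ⊔ b ⊔ ℓ₂)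
A <ᶜ B = A ≤ᶜ B × ¬ (B ≤ᶜ A)

2^ω : Setoid 0ℓ 0ℓ
2^ω = ℕ →-setoid Bool

Countable : Setoid a ℓ → Set (a ⊔ ℓ)
Countable A = A ≤ᶜ ≡.setoid ℕ

-- K is the minimal cardinality |X i| over all indices i satisfying P.
IsMinSize : {I : Set c} → (I → Setoid a ℓ₁) → Pred I p → Setoid b ℓ₂ →
            Set (c ⊔ a ⊔ ℓ₁ ⊔ p ⊔ b ⊔ ℓ₂)
IsMinSize X P K =
  (∃[ i ] (P i × X i ≈ᶜ K)) × (∀ i → P i → K ≤ᶜ X i)

-- Ordinals are represented by well-ordered sets.
record Ordinal : Set₁ where
  field
    strictTotalOrder : StrictTotalOrder 0ℓ 0ℓ 0ℓ
  open StrictTotalOrder strictTotalOrder public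
    using (Carrier; _≈_; _<_; module Eq; <-respˡ-≈)
  field
    wellFounded : WellFounded _<_

  setoid : Setoid 0ℓ 0ℓ
  setoid = Eq.setoid

  below : Carrier → Subset setoid
  below x = record { Mem = λ y → y < x ; resp = <-respˡ-≈ }

  Cofinal : Pred (Subset setoid) 0ℓ
  Cofinal A = ∀ x → ∃[ y ] (Mem A y × (x < y ⊎ x ≈ y))

∣_∣ : Ordinal → Setoid 0ℓ 0ℓ
∣ α ∣ = Ordinal.setoid α

-- The cardinal |A| as an initial ordinal.
IsCardinalOf : Ordinal → Setoid a ℓ → Set (a ⊔ ℓ)
IsCardinalOf κ A = ∣ κ ∣ ≈ᶜ A × (∀ x → ⟪ Ordinal.below κ x ⟫ <ᶜ ∣ κ ∣)

-- The least uncountable ordinal.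
IsOmega₁ : Ordinal → Set
IsOmega₁ α = ¬ Countable ∣ α ∣ × (∀ x → Countable ⟪ Ordinal.below α x ⟫)

-- cf |A| = |K|.
HasCofinality : Setoid a ℓ₁ → Setoid b ℓ₂ → Set (suc 0ℓ ⊔ a ⊔ ℓ₁ ⊔ b ⊔ ℓ₂)
HasCofinality A K =
  Σ[ κ ∈ Ordinal ] (IsCardinalOf κ A × IsMinSize ⟪_⟫ (Ordinal.Cofinal κ) K)

------------------------------------------------------------------------
-- The real line and category

-- A real number is a Dedekind cut of ℚ, given by its lower half.
record ℝ : Set₁ where
  field
    Lower      : Pred ℚ 0ℓ
    inhabited  : ∃[ q ] Lower q
    bounded    : ∃[ q ] ¬ Lower q
    downClosed : ∀ {q r} → q ℚ.< r → Lower r → Lower q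
    noGreatest : ∀ {q} → Lower q → ∃[ r ] (q ℚ.< r × Lower r)

open ℝ using (Lower)

ℝ-setoid : Setoid (suc 0ℓ) 0ℓ
ℝ-setoid = record
  { Carrier       = ℝ
  ; _≈_           = λ x y → Lower x ≐ Lower y
  ; isEquivalence = record { refl = ≐-refl ; sym = ≐-sym ; trans = ≐-trans }
  }

infix 4 _<ᴿ_

_<ᴿ_ : ℝ → ℝ → Set
x <ᴿ y = ∃[ q ] (¬ Lower x q × Lower y q)

Interval : ℝ → ℝ → Pred ℝ 0ℓ
Interval u v x = u <ᴿ x × x <ᴿ v

Interior : Pred ℝ ℓ → Pred ℝ (suc 0ℓ ⊔ ℓ)
Interior A x = ∃[ u ] ∃[ v ] (Interval u v x × Interval u v ⊆ A)

Closure : Pred ℝ ℓ → Pred ℝ (suc 0ℓ ⊔ ℓ)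
Closure A x = ∀ u v → Interval u v x → ∃[ y ] (Interval u v y × A y)

NowhereDense : Pred ℝ ℓ → Set (suc 0ℓ ⊔ ℓ)
NowhereDense A = Empty (Interior (Closure A))

Meagre : Subset ℝ-setoid → Set₁
Meagre A = Σ[ N ∈ (ℕ → Subset ℝ-setoid) ]
  ((∀ n → NowhereDense (Mem (N n))) × Mem A ≐ ⋃ ℕ (λ n → Mem (N n)))

MeagreCover : Subset (ℙ ℝ-setoid) → Set₁
MeagreCover 𝓕 =
  (∀ A → Mem 𝓕 A → Meagre A) × (∀ x → ∃[ A ] (Mem 𝓕 A × Mem A x))

-- Cov(meagre) = |K|.
HasCovMeagre : Setoid a ℓ → Set (suc 0ℓ ⊔ a ⊔ ℓ)
HasCovMeagre = IsMinSize ⟪_⟫ MeagreCover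

------------------------------------------------------------------------
-- First-order logic with equality

-- Constants are function symbols of arity 0.
record Language : Set₁ where
  field
    Fun Rel : Set
    arityᶠ  : Fun → ℕ
    arityᴿ  : Rel → ℕ

open Language

CountableLanguage : Language → Set
CountableLanguage L = (Fun L ⊎ Rel L) ↣ ℕ

record Structure (L : Language) : Set₁ where
  field
    domain : Setoid 0ℓ 0ℓ
  open Setoid domain public using (Carrier; _≈_)
  field
    fun      : (f : Fun L) → Vec Carrier (arityᶠ L f) → Carrier
    fun-cong : ∀ f {xs ys} → Pointwise _≈_ xs ys → fun f xs ≈ fun f ys
    rel      : (R : Rel L) → Vec Carrier (arityᴿ L R) → Set
    rel-resp : ∀ R {xs ys} → Pointwise _≈_ xs ys → rel R xs → rel R ys

module _ (L : Language) where

  -- Terms and formulas with free variables among n de Bruijn variables.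
  data Term (n : ℕ) : Set where
    var : Fin n → Term n
    app : (f : Fun L) → Vec (Term n) (arityᶠ L f) → Term n

  data Formula (n : ℕ) : Set where
    _≈ᶠ_ : Term n → Term n → Formula n
    relᶠ : (R : Rel L) → Vec (Term n) (arityᴿ L R) → Formula n
    ¬ᶠ_  : Formula n → Formula n
    _∧ᶠ_ : Formula n → Formula n → Formula n
    ∃ᶠ_  : Formula (ℕ.suc n) → Formula n

  Sentence : Set
  Sentence = Formula 0

module _ {L : Language} where

  module _ (M : Structure L) where
    open Structure M

    mutual
      ⟦_⟧ : ∀ {n} → Term L n → Vec Carrier n → Carrier
      ⟦ var i ⟧    ρ = lookup ρ i
      ⟦ app f ts ⟧ ρ = fun f (⟦ ts ⟧* ρ)

      ⟦_⟧* : ∀ {n k} → Vec (Term L n) k → Vec Carrier n → Vec Carrier k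
      ⟦ [] ⟧*     ρ = []
      ⟦ t ∷ ts ⟧* ρ = ⟦ t ⟧ ρ ∷ ⟦ ts ⟧* ρ

    Sat : ∀ {n} → Formula L n → Vec Carrier n → Set
    Sat (s ≈ᶠ t)    ρ = ⟦ s ⟧ ρ ≈ ⟦ t ⟧ ρ
    Sat (relᶠ R ts) ρ = rel R (⟦ ts ⟧* ρ)
    Sat (¬ᶠ φ)      ρ = ¬ Sat φ ρ
    Sat (φ ∧ᶠ ψ)    ρ = Sat φ ρ × Sat ψ ρ
    Sat (∃ᶠ φ)      ρ = ∃[ x ] Sat φ (x ∷ ρ)

  infix 4 _⊨_ _≡ₑ_ _≃_

  _⊨_ : Structure L → Sentence L → Set
  M ⊨ φ = Sat M φ []

  _≡ₑ_ : Structure L → Structure L → Set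
  M ≡ₑ N = ∀ φ → M ⊨ φ ⇔ N ⊨ φ

  record _≃_ (M N : Structure L) : Set where
    private
      module M = Structure M
      module N = Structure N
    field
      bijection : Bijection M.domain N.domain
    open Bijection bijection public using (to)
    field
      fun-pres : ∀ f xs → to (M.fun f xs) N.≈ N.fun f (Vec.map to xs)
      rel-pres : ∀ R xs → M.rel R xs ⇔ N.rel R (Vec.map to xs)

------------------------------------------------------------------------
-- Ultrafilters and ultrapowers

record Ultrafilter (I : Set) : Set₁ where
  field
    Large    : Pred (Pred I 0ℓ) 0ℓ
    whole    : Large U
    proper   : ¬ Large ∅
    upward   : ∀ {A B} → A ⊆ B → Large A → Large B
    inter    : ∀ {A B} → Large A → Large B → Large (A ∩ B)
    decisive : ∀ A → Large A ⊎ Large (∁ A)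

-- The ultrapower: functions I → M, identified when they agree on a large set.
module _ {L : Language} {I : Set} (M : Structure L) (𝓤 : Ultrafilter I) where
  open Structure M
  open Ultrafilter 𝓤
  private module S = Setoid domain

  infix 4 _~_

  _~_ : (I → Carrier) → (I → Carrier) → Set
  f ~ g = Large (λ i → f i ≈ g i)

  at : ∀ {k} → I → Vec (I → Carrier) k → Vec Carrier k
  at i = Vec.map (λ f → f i)

  ~-at : ∀ {k} {xs ys : Vec (I → Carrier) k} → Pointwise _~_ xs ys →
         Large (λ i → Pointwise _≈_ (at i xs) (at i ys))
  ~-at []       = upward (λ _ → []) whole
  ~-at (e ∷ es) = upward (λ (h , hs) → h ∷ hs) (inter e (~-at es))

  ultrapower : Structure L
  ultrapower = record
    { domain   = record
      { Carrier       = I → Carrier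
      ; _≈_           = _~_
      ; isEquivalence = record
        { refl  = upward (λ _ → S.refl) whole
        ; sym   = upward S.sym
        ; trans = λ p q → upward (λ (h , k) → S.trans h k) (inter p q)
        }
      }
    ; fun      = λ f xs i → fun f (at i xs)
    ; fun-cong = λ f es → upward (fun-cong f) (~-at es)
    ; rel      = λ R xs → Large (λ i → rel R (at i xs))
    ; rel-resp = λ R es r →
        upward (λ (h , k) → rel-resp R h k) (inter (~-at es) r)
    }

module Submission where

-- A well-ordered list of tasks, the functions ω → M and ω → N, is served by
-- pairs (f_t , g_t) ∈ M^ω × N^ω such that any finitely many formulas agree on
-- values of the f_t and g_t at infinitely many coordinates.  Given fewer than
-- 2^ω such pairs and a new f, a Cohen generic g : ω → C will do, for C a
-- countable subset of N closed under Skolem functions; it exists because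
-- Cov(meagre) = 2^ω.  The sets of coordinates on which formulas agree generate a
-- filter, and for any ultrafilter extending it f_t ↦ g_t induces an isomorphism.
--
-- To keep the values in countable sets, M and N are written as unions of
-- increasing ω₁-chains of countable Skolem hulls.  Every function ω → M takes its
-- values in some stage, so the tasks can be served stage by stage.  A stage must
-- not take 2^ω steps; since cf(2^ω) = ω₁, stage i may be restricted to tasks
-- numbered below the i-th member of a cofinal sequence, and then the tasks of
-- all stages up to i are bounded by some number below 2^ω.

open import Axiom.ExcludedMiddle using (ExcludedMiddle)
open import Data.Bool.Base using (Bool; true; false; not)
open import Data.Bool.Properties using (T-irrelevant; not-¬)
open import Data.Empty using (⊥-elim)
open import Data.Fin.Base using (Fin; zero; suc; toℕ; _↑ˡ_; _↑ʳ_)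
open import Data.Fin.Properties using (toℕ-injective)
open import Data.Integer.Base as ℤ using (ℤ; +_)
import Data.Integer.Properties as ℤP
open import Data.Integer.Tactic.RingSolver using (solve-∀)
open import Data.List.Base as List using (List; []; _∷_)
open import Data.List.Membership.Propositional using (_∈_)
open import Data.List.Membership.Propositional.Properties using (∈-++⁺ˡ; ∈-++⁺ʳ; ∈-++⁻; ∈-map⁺; ∈-map⁻)
import Data.List.Relation.Unary.All as ListAll
import Data.List.Relation.Unary.All.Properties as ListAllP
open import Data.List.Relation.Unary.Any using (here)
open import Data.Nat.Base as ℕ using (ℕ; zero; suc; _!)
open import Data.Nat.Divisibility using (_∣_; divides; ∣-trans; m∣m*n; m≤n⇒m!∣n!)
open import Data.Nat.Induction using (<-wellFounded)
import Data.Nat.Properties as ℕP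
open import Data.Product.Base as Product using (Σ-syntax; ∃; ∃-syntax; _×_; _,_; proj₁; proj₂; uncurry)
open import Data.Product.Function.NonDependent.Propositional using (_×-↣_)
open import Data.Product.Relation.Binary.Lex.Strict using (×-Lex; ×-wellFounded; ×-compare; ×-transitive)
open import Data.Rational.Base as ℚ using (ℚ)
import Data.Rational.Properties as ℚP
open import Data.Rational.Unnormalised.Base as ℚᵘ using (ℚᵘ; mkℚᵘ; *<*; *≡*; *≤*)
import Data.Rational.Unnormalised.Properties as ℚᵘP
open import Data.Sum.Base as Sum using (_⊎_; inj₁; inj₂; [_,_])
open import Data.Sum.Function.Propositional using (_⊎-↣_)
open import Data.Sum.Properties using (inj₁-injective; inj₂-injective)
open import Data.Vec.Base as Vec using (Vec; []; _∷_; lookup; _++_; tabulate)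
open import Data.Vec.Properties using (lookup-map; lookup-++ˡ; lookup-++ʳ; map-∘)
open import Data.Vec.Relation.Binary.Pointwise.Inductive as Pointwise using (Pointwise; []; _∷_)
open import Data.Vec.Relation.Unary.All as All using (All; []; _∷_)
import Data.Vec.Relation.Unary.All.Properties as AllP
open import Function.Base using (_on_; id; _∘_)
open import Function.Bundles using (Func; Injection; Bijection; _↣_; mk↣; _⇔_; mk⇔; Equivalence)
open import Function.Construct.Composition using (injection; _↣-∘_; _⇔-∘_)
open import Function.Construct.Identity using (↣-id)
open import Function.Construct.Symmetry using (⇔-sym)
open import Induction.WellFounded as WF using (WellFounded; Acc; acc)
open import Level using (Level; 0ℓ)
open import Relation.Binary.Bundles using (Setoid; StrictTotalOrder)
import Relation.Binary.Construct.On as On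
open import Relation.Binary.Core using (Rel)
open import Relation.Binary.Definitions using (Trichotomous; Transitive; Tri; tri<; tri≈; tri>)
open import Relation.Binary.PropositionalEquality as ≡
  using (_≡_; _≢_; _→-setoid_; refl; sym; trans; cong; subst)
open import Relation.Binary.PropositionalEquality.WithK using (≡-irrelevant)
open import Relation.Nullary.Decidable using (Dec; yes; no; does; True; toWitness; fromWitness; decidable-stable)
open import Relation.Nullary.Negation using (¬_; contradiction)
open import Relation.Unary using (Pred; _≐_; _⊆_; ∁)
open import Relation.Unary.Properties using (≐-refl; ≐-sym; ≐-trans)
open import Defs

open ListAll using () renaming (All to Allᴸ; [] to []ᴸ; _∷_ to _∷ᴸ_)
open ℝ using (Lower)

-- Cov(meagre) speaks about the real line, whereas a Cohen generic is a function ω → ω. The passage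
-- uses digits: at position n the digit of a real can be any natural number, and every interval
-- contains, for all large n, intervals of each prescribed digit. Hence the reals whose digits miss
-- a requirement from some position on form a nowhere dense set, provided that the requirement can
-- be met beyond every bound. The requirements at one step are finite tuples of earlier tasks
-- together with finite lists of formulas. That these are fewer than 2^ω rests on the theorem that
-- an infinite initial segment has as many pairs as elements. Being fewer than 2^ω is expressed
-- throughout by the absence of an embedding of 2^ω. Two recursions, the one that serves the tasks
-- and the one that extends a filter to an ultrafilter, preserve a property of all finite tuples of
-- earlier choices. Both are instances of `coherent`.

module Classical (em : ∀ ℓ → ExcludedMiddle ℓ) where

  private variable
    p q : Level
    A : Set p

  by-contradiction : {P : Set p} → ¬ ¬ P → P
  by-contradiction = decidable-stable (em _)

  ¬∀⇒∃¬ : {P : A → Set q} → ¬ (∀ x → P x) → ∃[ x ] ¬ P x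
  ¬∀⇒∃¬ ¬∀ = by-contradiction λ ¬∃ → ¬∀ λ x → by-contradiction λ ¬Px → ¬∃ (x , ¬Px)

  -- Excluded middle makes all propositions small and proof-irrelevant ...
  ∥_∥ : Set p → Set
  ∥ P ∥ = True (em _ {P})

  ∣_∣⁻ : {P : Set p} → ∥ P ∥ → P
  ∣_∣⁻ = toWitness

  ∣_∣⁺ : {P : Set p} → P → ∥ P ∥
  ∣_∣⁺ = fromWitness

  ∥∥-irrelevant : {P : Set p} (x y : ∥ P ∥) → x ≡ y
  ∥∥-irrelevant = T-irrelevant

  Sub : {A : Set} → (A → Set q) → Set
  Sub Q = ∃[ x ] ∥ Q x ∥

  Sub-≡ : {A : Set} {Q : A → Set q} {x y : Sub Q} → proj₁ x ≡ proj₁ y → x ≡ y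
  Sub-≡ {x = x , p} {.x , q} refl = cong (x ,_) (∥∥-irrelevant p q)

  -- ... and, existence being witnessed, also yields Hilbert's ε.
  abstract
    ε : (P : A → Set q) → A → A
    ε P default with em _ {∃ P}
    ... | yes (x , _) = x
    ... | no _        = default

    ε-spec : {P : A → Set q} {default : A} → ∃ P → P (ε P default)
    ε-spec {P = P} ∃P with em _ {∃ P}
    ... | yes (_ , Px) = Px
    ... | no ¬∃P       = contradiction ∃P ¬∃P

    ε-default : (P : A → Set q) (default : A) → P (ε P default) ⊎ ε P default ≡ default
    ε-default P default with em _ {∃ P}
    ... | yes (_ , Px) = inj₁ Px
    ... | no _         = inj₂ refl

-- Cohen reals from Cov(meagre)

numer : ℤ → ℕ → ℤ
numer m v = m ℤ.* + suc v ℤ.+ + v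

-- The point (m + v/(v+1)) / (d+1).
grid : ℕ → ℤ → ℕ → ℚᵘ
grid d m v = mkℚᵘ (numer m v) (v ℕ.+ d ℕ.* suc v)

<-from-gap : ∀ {x y} d → y ≡ x ℤ.+ + suc d → x ℤ.< y
<-from-gap {x} d refl = subst (ℤ._< x ℤ.+ + suc d) (ℤP.+-identityʳ x) (ℤP.+-monoʳ-< x (ℤ.+<+ ℕ.z<s))

-- After cross-multiplication the two sides differ by exactly d + 1, because (v + 1)² = v (v + 2) +
-- 1; in `identity`, `D` stands for d + 1.
grid-suc : ∀ d m v → grid d m v ℚᵘ.< grid d m (suc v)
grid-suc d m v = *<* (<-from-gap d
  (trans (cong (numer m (suc v) ℤ.*_) (ℤP.pos-* (suc d) (suc v)))
  (trans (identity m (+ suc d) (+ v))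
  (cong (λ D → numer m v ℤ.* D ℤ.+ + suc d) (sym (ℤP.pos-* (suc d) (suc (suc v))))))))
  where
  identity : ∀ m D v →
    (m ℤ.* (+ 2 ℤ.+ v) ℤ.+ (+ 1 ℤ.+ v)) ℤ.* (D ℤ.* (+ 1 ℤ.+ v)) ≡
    (m ℤ.* (+ 1 ℤ.+ v) ℤ.+ v) ℤ.* (D ℤ.* (+ 2 ℤ.+ v)) ℤ.+ D
  identity = solve-∀

grid-top : ∀ d m v → grid d m v ℚᵘ.< grid d (ℤ.suc m) 0
grid-top d m v = *<* (<-from-gap d
  (trans (cong (numer (ℤ.suc m) 0 ℤ.*_) (ℤP.pos-* (suc d) (suc v)))
  (trans (identity m (+ suc d) (+ v))
  (cong (λ D → numer m v ℤ.* D ℤ.+ + suc d) (sym (ℤP.pos-* (suc d) 1))))))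
  where
  identity : ∀ m D v →
    ((+ 1 ℤ.+ m) ℤ.* + 1 ℤ.+ + 0) ℤ.* (D ℤ.* (+ 1 ℤ.+ v)) ≡
    (m ℤ.* (+ 1 ℤ.+ v) ℤ.+ v) ℤ.* (D ℤ.* + 1) ℤ.+ D
  identity = solve-∀

grid-mono-≤ : ∀ d m {v w} → v ℕ.≤ w → grid d m v ℚᵘ.≤ grid d m w
grid-mono-≤ d m {v} {w} v≤w with ℕP.≤⇒≤′ v≤w
... | ℕ.≤′-refl = ℚᵘP.≤-refl
... | ℕ.≤′-step v≤′w = ℚᵘP.≤-trans (grid-mono-≤ d m (ℕP.≤′⇒≤ v≤′w)) (ℚᵘP.<⇒≤ (grid-suc d m _))

grid-int-≤ : ∀ d {m m′} → m ℤ.≤ m′ → grid d m 0 ℚᵘ.≤ grid d m′ 0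
grid-int-≤ d m≤m′ = *≤* (ℤP.*-monoʳ-≤-nonNeg (+ suc (d ℕ.* 1))
  (ℤP.+-monoˡ-≤ (+ 0) (ℤP.*-monoʳ-≤-nonNeg (+ 1) m≤m′)))

grid-<-int : ∀ d {m m′} v w → m ℤ.< m′ → grid d m v ℚᵘ.< grid d m′ w
grid-<-int d {m} {m′} v w m<m′ = ℚᵘP.<-≤-trans (grid-top d m v)
  (ℚᵘP.≤-trans (grid-int-≤ d {ℤ.suc m} {m′} (ℤP.i<j⇒suc[i]≤j m<m′)) (grid-mono-≤ d m′ ℕ.z≤n))

-- The half-open intervals between consecutive grid points are disjoint.
grid-disjoint : ∀ d {m m′ v v′} → grid d m v ℚᵘ.< grid d m′ (suc v′) → grid d m′ v′ ℚᵘ.< grid d m (suc v) → v ≡ v′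
grid-disjoint d {m} {m′} {v} {v′} p q with ℤP.<-cmp m m′
... | tri< m<m′ _ _ = ⊥-elim (ℚᵘP.<-asym q (grid-<-int d (suc v) v′ m<m′))
... | tri> _ _ m′<m = ⊥-elim (ℚᵘP.<-asym p (grid-<-int d (suc v′) v m′<m))
... | tri≈ _ refl _ = ℕP.≤-antisym (lem p) (lem q)
  where
  lem : ∀ {v w} → grid d m v ℚᵘ.< grid d m (suc w) → v ℕ.≤ w
  lem {v} {w} r = ℕP.≮⇒≥ λ w<v → ℚᵘP.<-irrefl ℚᵘP.≃-refl (ℚᵘP.<-≤-trans r (grid-mono-≤ d m w<v))

on-grid : ∀ d (a : ℚ) → ℚ.↧ₙ a ∣ suc d → ∃[ m ] (ℚ.toℚᵘ a ℚᵘ.≃ grid d m 0)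
on-grid d a@record{} (divides q eq) = ℚ.↥ a ℤ.* + q , *≡* (
  trans (cong (λ z → ℚ.↥ a ℤ.* + z) (trans (cong suc (ℕP.*-identityʳ d)) eq))
  (trans (cong (ℚ.↥ a ℤ.*_) (ℤP.pos-* q (ℚ.↧ₙ a))) (identity (ℚ.↥ a) (+ q) (ℚ.↧ a))))
  where
  identity : ∀ x q y → x ℤ.* (q ℤ.* y) ≡ (x ℤ.* q ℤ.* + 1 ℤ.+ + 0) ℤ.* y
  identity = solve-∀

grid-int-cancel : ∀ d {m m′} → grid d m 0 ℚᵘ.< grid d m′ 0 → m ℤ.< m′
grid-int-cancel d {m} {m′} p = ℤP.≰⇒> λ m′≤m → ℚᵘP.<-irrefl ℚᵘP.≃-refl (ℚᵘP.<-≤-trans p (grid-int-≤ d m′≤m))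

fromℚᵘ-mono-< : ∀ {x y} → x ℚᵘ.< y → ℚ.fromℚᵘ x ℚ.< ℚ.fromℚᵘ y
fromℚᵘ-mono-< {x} {y} x<y = ℚP.toℚᵘ-cancel-<
  (ℚᵘP.<-respˡ-≃ (ℚᵘP.≃-sym (ℚP.toℚᵘ-fromℚᵘ x)) (ℚᵘP.<-respʳ-≃ (ℚᵘP.≃-sym (ℚP.toℚᵘ-fromℚᵘ y)) x<y))

fromℚᵘ-cancel-< : ∀ {x y} → ℚ.fromℚᵘ x ℚ.< ℚ.fromℚᵘ y → x ℚᵘ.< y
fromℚᵘ-cancel-< {x} {y} p =
  ℚᵘP.<-respˡ-≃ (ℚP.toℚᵘ-fromℚᵘ x) (ℚᵘP.<-respʳ-≃ (ℚP.toℚᵘ-fromℚᵘ y) (ℚP.toℚᵘ-mono-< p))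

fromℚᵘ-mono-≤ : ∀ {x y} → x ℚᵘ.≤ y → ℚ.fromℚᵘ x ℚ.≤ ℚ.fromℚᵘ y
fromℚᵘ-mono-≤ {x} {y} x≤y = ℚP.toℚᵘ-cancel-≤
  (ℚᵘP.≤-respˡ-≃ (ℚᵘP.≃-sym (ℚP.toℚᵘ-fromℚᵘ x)) (ℚᵘP.≤-respʳ-≃ (ℚᵘP.≃-sym (ℚP.toℚᵘ-fromℚᵘ y)) x≤y))

abstract
  point : ℕ → ℤ → ℕ → ℚ
  point d m v = ℚ.fromℚᵘ (grid d m v)

  point-suc : ∀ d m v → point d m v ℚ.< point d m (suc v)
  point-suc d m v = fromℚᵘ-mono-< (grid-suc d m v)

  point-mono-≤ : ∀ d m {v w} → v ℕ.≤ w → point d m v ℚ.≤ point d m w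
  point-mono-≤ d m v≤w = fromℚᵘ-mono-≤ (grid-mono-≤ d m v≤w)

  point-<-int : ∀ d {m m′} v w → m ℤ.< m′ → point d m v ℚ.< point d m′ w
  point-<-int d v w m<m′ = fromℚᵘ-mono-< (grid-<-int d v w m<m′)

  point-int-cancel : ∀ d {m m′} → point d m 0 ℚ.< point d m′ 0 → m ℤ.< m′
  point-int-cancel d {m} {m′} p = grid-int-cancel d {m} {m′} (fromℚᵘ-cancel-< p)

  point-disjoint : ∀ d {m m′ v w} → point d m v ℚ.< point d m′ (suc w) →
                   point d m′ w ℚ.< point d m (suc v) → v ≡ w
  point-disjoint d {m} {m′} {v} {w} p q =
    grid-disjoint d {m} {m′} {v} {w} (fromℚᵘ-cancel-< p) (fromℚᵘ-cancel-< q)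

  on-points : ∀ d (a : ℚ) → ℚ.↧ₙ a ∣ suc d → ∃[ m ] a ≡ point d m 0
  on-points d a a∣d with on-grid d a a∣d
  ... | m , a≃ = m , trans (sym (ℚP.fromℚᵘ-toℚᵘ a)) (ℚP.fromℚᵘ-cong a≃)

  -- n! is used as the denominator so that eventually every rational is a grid point.
  fine : ℕ → ℕ
  fine n = ℕ.pred (n !)

  ∣-fine : ∀ {a n} → suc a ℕ.≤ n → suc a ∣ suc (fine n)
  ∣-fine {a} {n} a<n = subst (suc a ∣_) (sym (ℕP.suc-pred (n !) {{ℕP._!≢0 n}}))
    (∣-trans (m∣m*n (a !)) (m≤n⇒m!∣n! a<n))

-- Once n! is a multiple of both denominators, `a` and `b` are integer points of the grid. The block
-- that starts at `a` then ends no later than `b`, and it contains an interval for every `v`.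
subinterval : ∀ {a b : ℚ} → a ℚ.< b → ∃[ k ] (∀ n v → k ℕ.≤ n → ∃[ m ]
  (a ℚ.≤ point (fine n) m v × point (fine n) m (suc v) ℚ.≤ b))
subinterval {a} {b} a<b = ℚ.↧ₙ a ℕ.⊔ ℚ.↧ₙ b , go
  where
  go : ∀ n v → ℚ.↧ₙ a ℕ.⊔ ℚ.↧ₙ b ℕ.≤ n → ∃[ m ]
    (a ℚ.≤ point (fine n) m v × point (fine n) m (suc v) ℚ.≤ b)
  go n v k≤n with on-points (fine n) a (∣-fine (ℕP.m⊔n≤o⇒m≤o (ℚ.↧ₙ a) (ℚ.↧ₙ b) k≤n))
                | on-points (fine n) b (∣-fine (ℕP.m⊔n≤o⇒n≤o (ℚ.↧ₙ a) (ℚ.↧ₙ b) k≤n))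
  ... | m , a≡ | m′ , b≡ = m ,
    subst (ℚ._≤ point (fine n) m v) (sym a≡) (point-mono-≤ (fine n) m ℕ.z≤n) ,
    subst (point (fine n) m (suc v) ℚ.≤_) (sym b≡) (ℚP.<⇒≤ (point-<-int (fine n) (suc v) 0
      (point-int-cancel (fine n) (≡.subst₂ ℚ._<_ a≡ b≡ a<b))))

-- Digits of real numbers

rational : ℚ → ℝ
rational q = record
  { Lower      = ℚ._< q
  ; inhabited  = q ℚ.- ℚ.1ℚ ,
                 subst (q ℚ.- ℚ.1ℚ ℚ.<_) (ℚP.+-identityʳ q)
                   (ℚP.+-monoʳ-< q {ℚ.- ℚ.1ℚ} {ℚ.0ℚ} (ℚP.negative⁻¹ _))
  ; bounded    = q , ℚP.<-irrefl refl
  ; downClosed = ℚP.<-trans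
  ; noGreatest = ℚP.<-dense
  }

-- p < y ≤ q
Within : ℚ → ℚ → ℝ → Set
Within p q y = Lower y p × ¬ Lower y q

Lower-≤ : ∀ y {p q} → p ℚ.≤ q → Lower y q → Lower y p
Lower-≤ y {p} {q} p≤q l with ℚP.<-cmp p q
... | tri< p<q _ _ = ℝ.downClosed y p<q l
... | tri≈ _ refl _ = l
... | tri> _ _ q<p = contradiction (ℚP.<-≤-trans q<p p≤q) (ℚP.<-irrefl refl)

Within-< : ∀ y {p q r s} → Within p q y → Within r s y → p ℚ.< s
Within-< y (l , _) (_ , u) = ℚP.≰⇒> λ s≤p → u (Lower-≤ y s≤p l)

-- Every block of the grid is cut into infinitely many intervals, so that digits range over all of
-- ω. The relation is partial: integer points of the grid lie in none of the intervals.
Digit : ℝ → ℕ → ℕ → Set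
Digit y n v = ∃[ m ] Within (point (fine n) m v) (point (fine n) m (suc v)) y

Digit-functional : ∀ y n {v w} → Digit y n v → Digit y n w → v ≡ w
Digit-functional y n {v} {w} (m , p) (m′ , q) =
  point-disjoint (fine n) (Within-< y p q) (Within-< y q p)

module Cohen (em : ∀ ℓ → ExcludedMiddle ℓ)
             (ac : ∀ a ℓ₁ b ℓ₂ r → AxiomOfChoice a ℓ₁ b ℓ₂ r)
             (cov : HasCovMeagre 2^ω)
             where
  open Classical em

  avoiding : (ℕ → Pred ℕ 0ℓ) → ℕ → Subset ℝ-setoid
  avoiding W k = record
    { Mem  = λ y → ∀ n v → k ℕ.≤ n → Digit y n v → ¬ W n v
    ; resp = λ (y⊆y′ , y′⊆y) h n v k≤n (m , l , u) → h n v k≤n (m , y′⊆y l , λ l′ → u (y⊆y′ l′))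
    }

  -- An interval inside the closure contains a whole digit interval for some position n beyond `k`
  -- and some `w` allowed by `W n`. The closure reaches into it, so some member of the set has the
  -- forbidden digit `w`.
  avoiding-nowhereDense : ∀ W → (∀ k → ∃[ n ] (k ℕ.≤ n × ∃ (W n))) →
                          ∀ k → NowhereDense (Mem (avoiding W k))
  avoiding-nowhereDense W W-inhabited k z (u , v , ((a , ¬u<a , a<z) , (b , ¬z<b , b<v)) , I⊆C)
    with subinterval (Within-< z (a<z , ¬z<b) (a<z , ¬z<b))
  ... | k₁ , sub with W-inhabited (k ℕ.⊔ k₁)
  ... | n , k⊔k₁≤n , w , Ww with sub n w (ℕP.m⊔n≤o⇒n≤o k k₁ k⊔k₁≤n)
  -- The rational `c` strictly inside the digit interval is the point of the closure to which the
  -- neighbourhood (p, q) is applied.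
  ... | m , a≤p , q≤b with ℚP.<-dense (point-suc (fine n) m w)
  ... | c , p<c , c<q with I⊆C {rational c}
                               ((a , ¬u<a , ℚP.≤-<-trans a≤p p<c) , (b , ℚP.<-asym (ℚP.<-≤-trans c<q q≤b) , b<v))
                               (rational p) (rational q) ((p , ℚP.<-irrefl refl , p<c) , (c , ℚP.<-irrefl refl , c<q))
    where p = point (fine n) m w
          q = point (fine n) m (suc w)
  ... | y , ((r , r≮p , r<y) , (s , s≮y , s<q)) , avoids =
    avoids n w (ℕP.m⊔n≤o⇒m≤o k k₁ k⊔k₁≤n)
      (m , Lower-≤ y (ℚP.≮⇒≥ r≮p) r<y , λ q<y → s≮y (ℝ.downClosed y s<q q<y)) Ww

  abstract
    -- The reals that fail requirement `x` from some position on form a meagre set. If these sets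
    -- covered the line, there would be at least 2^ω of them and 2^ω would embed into `X`. The
    -- digits of an uncovered real are the generic function.
    cohen-generic : ∀ {X : Set} → ¬ (2^ω ≤ᶜ ≡.setoid X) →
                    (W : X → ℕ → Pred ℕ 0ℓ) →
                    (∀ x k → ∃[ n ] (k ℕ.≤ n × ∃ (W x n))) →
                    Σ[ g ∈ (ℕ → ℕ) ] (∀ x k → ∃[ n ] (k ℕ.≤ n × W x n (g n)))
    cohen-generic {X} X-small W W-inhabited = g , g-generic
      where
      bad : X → Subset ℝ-setoid
      bad x = record
        { Mem  = λ y → ∃[ k ] Mem (avoiding (W x) k) y
        ; resp = λ {y} {y′} y≈y′ (k , h) → k , Subset.resp (avoiding (W x) k) {y} {y′} y≈y′ h
        }

      𝓕 : Subset (ℙ ℝ-setoid)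
      𝓕 = record
        { Mem  = λ A → ∥ (∃[ x ] Mem A ≐ Mem (bad x)) ∥
        ; resp = λ A≐B A∈𝓕 → let x , A≐bad = ∣ A∈𝓕 ∣⁻ in ∣ x , ≐-trans (≐-sym A≐B) A≐bad ∣⁺
        }

      𝓕≤X : ⟪ 𝓕 ⟫ ≤ᶜ ≡.setoid X
      𝓕≤X with ac _ _ _ _ _ ⟪ 𝓕 ⟫ (≡.setoid X) (λ A x → Mem (proj₁ A) ≐ Mem (bad x))
                  (λ { A≐B refl A≐bad → ≐-trans (≐-sym A≐B) A≐bad }) (λ A → ∣ proj₂ A ∣⁻)
      ... | f , spec = record
        { to        = Func.to f
        ; cong      = Func.cong f
        ; injective = λ {A} {B} fA≡fB →
            ≐-trans (spec A) (≐-trans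
              (subst (λ x → Mem (bad (Func.to f A)) ≐ Mem (bad x)) fA≡fB ≐-refl) (≐-sym (spec B)))
        }

      uncovered : ∃[ y ] ∀ x → ¬ Mem (bad x) y
      uncovered with ¬∀⇒∃¬ (λ covers → X-small (injection (proj₂ cov 𝓕 (meagre , covers)) 𝓕≤X))
        where
        meagre : ∀ A → Mem 𝓕 A → Meagre A
        meagre A A∈𝓕 = let x , A≐bad = ∣ A∈𝓕 ∣⁻ in
          avoiding (W x) , avoiding-nowhereDense (W x) (W-inhabited x) , A≐bad
      ... | y , ¬covered = y , λ x y∈bad → ¬covered (bad x , ∣ x , ≐-refl ∣⁺ , y∈bad)

      y : ℝ
      y = proj₁ uncovered

      g : ℕ → ℕ
      -- The default 0 is harmless: a failure of requirement `x` from `k` on would already put `y`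
      -- into `bad x`, which looks only at digits that exist.
      g n = ε (Digit y n) 0

      g-generic : ∀ x k → ∃[ n ] (k ℕ.≤ n × W x n (g n))
      g-generic x k = by-contradiction λ ¬∃ → proj₂ uncovered x (k , λ n v k≤n digit Wv →
        ¬∃ (n , k≤n , subst (W x n) (Digit-functional y n digit (ε-spec (v , digit))) Wv))

-- Well-orders

to : ∀ {a b} {A : Set a} {B : Set b} → A ↣ B → A → B
to = Injection.to

injective : ∀ {a b} {A : Set a} {B : Set b} (f : A ↣ B) → ∀ {x y} → to f x ≡ to f y → x ≡ y
injective = Injection.injective

infixr 9 _∘↣_

_∘↣_ : ∀ {a b c} {A : Set a} {B : Set b} {C : Set c} → B ↣ C → A ↣ B → A ↣ C
_∘↣_ = _↣-∘_

-- (a , b) ↦ 2^a (2b + 1)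
pair : ℕ → ℕ → ℕ
pair zero    b = suc (b ℕ.+ b)
pair (suc a) b = pair a b ℕ.+ pair a b

double-injective : ∀ m n → m ℕ.+ m ≡ n ℕ.+ n → m ≡ n
double-injective zero    zero    _  = refl
double-injective (suc m) (suc n) eq = cong suc (double-injective m n
  (ℕP.suc-injective (trans (sym (ℕP.+-suc m m)) (trans (ℕP.suc-injective eq) (ℕP.+-suc n n)))))

odd≢even : ∀ m n → suc (m ℕ.+ m) ≢ n ℕ.+ n
odd≢even zero    (suc n) eq with trans (ℕP.suc-injective eq) (ℕP.+-suc n n)
... | ()
odd≢even (suc m) (suc n) eq = odd≢even m n (ℕP.suc-injective
  (trans (cong suc (sym (ℕP.+-suc m m))) (trans (ℕP.suc-injective eq) (ℕP.+-suc n n))))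

pair-injective : ∀ a b c d → pair a b ≡ pair c d → a ≡ c × b ≡ d
pair-injective zero    b zero    d eq = refl , double-injective b d (ℕP.suc-injective eq)
pair-injective zero    b (suc c) d eq = ⊥-elim (odd≢even b (pair c d) eq)
pair-injective (suc a) b zero    d eq = ⊥-elim (odd≢even d (pair a b) (sym eq))
pair-injective (suc a) b (suc c) d eq with pair-injective a b c d (double-injective _ _ eq)
... | refl , b≡d = refl , b≡d

ℕ×ℕ↣ℕ : (ℕ × ℕ) ↣ ℕ
ℕ×ℕ↣ℕ = mk↣ {to = uncurry pair} λ {(a , b)} {(c , d)} eq →
  let a≡c , b≡d = pair-injective a b c d eq in ≡.cong₂ _,_ a≡c b≡d

absorb : ∀ {A : Set} → ((A ⊎ ℕ) ⊎ ℕ) ↣ (A ⊎ ℕ)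
absorb = mk↣ {to = f} inj
  where
  f : _ → _
  f (inj₁ (inj₁ a)) = inj₁ a
  f (inj₁ (inj₂ n)) = inj₂ (pair 0 n)
  f (inj₂ n)        = inj₂ (pair 1 n)

  inj : ∀ {x y} → f x ≡ f y → x ≡ y
  inj {inj₁ (inj₁ a)} {inj₁ (inj₁ .a)} refl = refl
  inj {inj₁ (inj₂ m)} {inj₁ (inj₂ n)}  eq
    with refl ← proj₂ (pair-injective 0 m 0 n (inj₂-injective eq)) = refl
  inj {inj₁ (inj₂ m)} {inj₂ n}         eq with proj₁ (pair-injective 0 m 1 n (inj₂-injective eq))
  ... | ()
  inj {inj₂ m}        {inj₁ (inj₂ n)}  eq with proj₁ (pair-injective 1 m 0 n (inj₂-injective eq))
  ... | ()
  inj {inj₂ m}        {inj₂ n}         eq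
    with refl ← proj₂ (pair-injective 1 m 1 n (inj₂-injective eq)) = refl

-- Formulas, Skolem terms and contexts are all coded by binary trees, which embed into any set that
-- has a pairing function and two distinct elements.
data Tree (A : Set) : Set where
  leaf : A → Tree A
  _·_  : Tree A → Tree A → Tree A

infixr 5 _·_

leaf-injective : ∀ {A} {x y : A} → leaf x ≡ leaf y → x ≡ y
leaf-injective refl = refl

·-injective : ∀ {A} {x y z w : Tree A} → x · y ≡ z · w → x ≡ z × y ≡ w
·-injective refl = refl , refl

module _ {A : Set} (p : (A × A) ↣ A) {a₀ a₁ : A} (a₀≢a₁ : a₀ ≢ a₁) where
  private
    flat : Tree A → A
    flat (leaf a) = to p (a₀ , a)
    flat (s · t)  = to p (a₁ , to p (flat s , flat t))

    flat-injective : ∀ s t → flat s ≡ flat t → s ≡ t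
    flat-injective (leaf a) (leaf b) eq with refl ← injective p eq = refl
    flat-injective (leaf a) (t · u)  eq = ⊥-elim (a₀≢a₁ (cong proj₁ (injective p eq)))
    flat-injective (s · r)  (leaf b) eq = ⊥-elim (a₀≢a₁ (sym (cong proj₁ (injective p eq))))
    flat-injective (s · r)  (t · u)  eq =
      let eq′ = injective p (cong proj₂ (injective p eq)) in
      ≡.cong₂ _·_ (flat-injective s t (cong proj₁ eq′)) (flat-injective r u (cong proj₂ eq′))

  Tree↣ : Tree A ↣ A
  Tree↣ = mk↣ {to = flat} (λ {s} {t} → flat-injective s t)

Treeℕ↣ℕ : Tree ℕ ↣ ℕ
Treeℕ↣ℕ = Tree↣ ℕ×ℕ↣ℕ {0} {1} λ ()

-- In contrast to `Ordinal`, equality is propositional, so that functions on the carrier respect it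
-- automatically; `Canonical` passes from one notion to the other.
record WellOrder : Set₁ where
  infix 4 _<_
  field
    Carrier     : Set
    _<_         : Rel Carrier 0ℓ
    wellFounded : WellFounded _<_
    <-trans     : Transitive _<_
    compare     : Trichotomous _≡_ _<_

ℕ-wellOrder : WellOrder
ℕ-wellOrder = record
  { wellFounded = <-wellFounded
  ; <-trans     = ℕP.<-trans
  ; compare     = ℕP.<-cmp
  }

infixr 2 _×ₗ_

_×ₗ_ : WellOrder → WellOrder → WellOrder
V ×ₗ W = record
  { Carrier     = V.Carrier × W.Carrier
  ; _<_         = ×-Lex _≡_ V._<_ W._<_
  ; wellFounded = ×-wellFounded V.wellFounded W.wellFounded
  ; <-trans     = λ {x} {y} {z} → ×-transitive {_<₂_ = W._<_} ≡.isEquivalence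
                    (≡.resp₂ V._<_) V.<-trans W.<-trans {x} {y} {z}
  ; compare     = λ x y → ≡-tri (×-compare sym V.compare W.compare x y)
  }
  where
  module V = WellOrder V
  module W = WellOrder W
  ≡-tri : ∀ {x y} → Tri (×-Lex _≡_ V._<_ W._<_ x y) (proj₁ x ≡ proj₁ y × proj₂ x ≡ proj₂ y)
              (×-Lex _≡_ V._<_ W._<_ y x) →
          Tri (×-Lex _≡_ V._<_ W._<_ x y) (x ≡ y) (×-Lex _≡_ V._<_ W._<_ y x)
  ≡-tri (tri< a ¬b ¬c) = tri< a (λ { refl → ¬b (refl , refl) }) ¬c
  ≡-tri (tri≈ ¬a (refl , refl) ¬c) = tri≈ ¬a refl ¬c
  ≡-tri (tri> ¬a ¬b c) = tri> ¬a (λ { refl → ¬b (refl , refl) }) c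

pullback : ∀ {A : Set} (W : WellOrder) → A ↣ WellOrder.Carrier W → WellOrder
pullback W f = record
  { _<_         = W._<_ on to f
  ; wellFounded = On.wellFounded (to f) W.wellFounded
  ; <-trans     = W.<-trans
  ; compare     = λ x y → ≡-tri (W.compare (to f x) (to f y))
  }
  where
  module W = WellOrder W
  ≡-tri : ∀ {x y} → Tri (to f x W.< to f y) (to f x ≡ to f y) (to f y W.< to f x) →
          Tri (to f x W.< to f y) (x ≡ y) (to f y W.< to f x)
  ≡-tri (tri< a ¬b ¬c) = tri< a (λ { refl → ¬b refl }) ¬c
  ≡-tri (tri≈ ¬a b ¬c) = tri≈ ¬a (injective f b) ¬c
  ≡-tri (tri> ¬a ¬b c) = tri> ¬a (λ { refl → ¬b refl }) c

-- Choice, transfinite recursion and cardinal arithmetic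

module Choice (em : ∀ ℓ → ExcludedMiddle ℓ)
              (ac : ∀ a ℓ₁ b ℓ₂ r → AxiomOfChoice a ℓ₁ b ℓ₂ r) where
  open Classical em

  -- Choosing from `S` into the propositional setoid on the same carrier forces equivalent elements
  -- to receive identical values.
  representatives : ∀ {a ℓ} (S : Setoid a ℓ) → let open Setoid S in
                    Σ[ f ∈ (Carrier → Carrier) ] ((∀ {x y} → x ≈ y → f x ≡ f y) × (∀ x → x ≈ f x))
  representatives S with ac _ _ _ _ _ S (≡.setoid _) (Setoid._≈_ S)
    (λ { x≈x′ refl x≈y → Setoid.trans S (Setoid.sym S x≈x′) x≈y }) (λ x → x , Setoid.refl S)
  ... | f , spec = Func.to f , Func.cong f , spec

  module _ (W : WellOrder) where
    open WellOrder W

    -- Setoid choice makes each choice depend on the history only extensionally;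
    -- without function extensionality the recursion equation would fail otherwise.
    module _ {a p} {R : Set a}
             (P : Carrier → (Carrier → R) → R → Set p)
             (P-local : ∀ t {H H′ r} → (∀ s → s < t → H s ≡ H′ s) → P t H r → P t H′ r)
             (r₀ : R) (step : ∀ t H → ∃[ r ] P t H r)
             where
      private
        chosen : ∀ t → Σ[ f ∈ Func (Carrier →-setoid R) (≡.setoid R) ] (∀ H → P t H (Func.to f H))
        chosen t = ac _ _ _ _ _ (Carrier →-setoid R) (≡.setoid R) (P t)
          (λ { H≗H′ refl → P-local t λ s _ → H≗H′ s }) (step t)

        restrict : ∀ t → (∀ s → s < t → R) → Carrier → R
        restrict t H s with em _ {s < t}
        ... | yes s<t = H s s<t
        ... | no _    = r₀

        restrict-cong : ∀ t {H H′} → (∀ s s<t → H s s<t ≡ H′ s s<t) → ∀ s → restrict t H s ≡ restrict t H′ s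
        restrict-cong t H≡H′ s with em _ {s < t}
        ... | yes s<t = H≡H′ s s<t
        ... | no _    = refl

        build : ∀ t → Acc _<_ t → R
        build t (acc rs) = Func.to (proj₁ (chosen t)) (restrict t λ s s<t → build s (rs s<t))

        build-irrelevant : ∀ t (a b : Acc _<_ t) → build t a ≡ build t b
        build-irrelevant t (acc rs) (acc rs′) = Func.cong (proj₁ (chosen t))
          (restrict-cong t λ s s<t → build-irrelevant s (rs s<t) (rs′ s<t))

        restrict-build : ∀ t (rs : ∀ {s} → s < t → Acc _<_ s) s → s < t →
                         restrict t (λ s s<t → build s (rs s<t)) s ≡ build s (wellFounded s)
        restrict-build t rs s s<t with em _ {s < t}
        ... | yes s<t′ = build-irrelevant s (rs s<t′) (wellFounded s)
        ... | no s≮t   = ⊥-elim (s≮t s<t)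

        build-spec : ∀ t (a : Acc _<_ t) → P t (λ s → build s (wellFounded s)) (build t a)
        build-spec t (acc rs) = P-local t (restrict-build t rs) (proj₂ (chosen t) _)

      abstract
        wf-choice : Σ[ h ∈ (Carrier → R) ] (∀ t → P t h (h t))
        wf-choice = (λ t → build t (wellFounded t)) , λ t → build-spec t (wellFounded t)

    -- Greedy recursion: every point takes a value not taken by its predecessors, and one is left
    -- because no proper segment is mapped onto `D`.
    inject-wellOrder : {D : Set} → D →
                       (∀ w (H : Carrier → D) → ¬ (∀ d → ∃[ s ] (s < w × H s ≡ d))) →
                       Carrier ↣ D
    inject-wellOrder d₀ not-onto
      with wf-choice (λ t H d → ∀ s → s < t → H s ≢ d)
             (λ t H≡H′ fresh s s<t H′s≡d → fresh s s<t (trans (H≡H′ s s<t) H′s≡d))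
             d₀
             (λ t H → let d , new = ¬∀⇒∃¬ (not-onto t H) in d , λ s s<t Hs≡d → new (s , s<t , Hs≡d))
    ... | h , fresh = mk↣ inj
      where
      inj : ∀ {x y} → h x ≡ h y → x ≡ y
      inj {x} {y} hx≡hy with compare x y
      ... | tri< x<y _ _ = ⊥-elim (fresh y x x<y hx≡hy)
      ... | tri≈ _ x≡y _ = x≡y
      ... | tri> _ _ y<x = ⊥-elim (fresh x y y<x (sym hx≡hy))

  module Segments (W : WellOrder) where
    open WellOrder W

    Below : Carrier → Set
    Below d = Sub (_< d)

    Below-mono : ∀ {d e} → d < e → Below d ↣ Below e
    Below-mono d<e = mk↣ {to = λ (x , x<d) → x , ∣ <-trans ∣ x<d ∣⁻ d<e ∣⁺} (λ eq → Sub-≡ (cong proj₁ eq))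

    max : Carrier → Carrier → Carrier
    max x y with compare x y
    ... | tri< _ _ _ = y
    ... | tri≈ _ _ _ = x
    ... | tri> _ _ _ = x

    _≤_ : Carrier → Carrier → Set
    x ≤ y = x < y ⊎ x ≡ y

    ≤-trans : ∀ {x y z} → x ≤ y → y ≤ z → x ≤ z
    ≤-trans (inj₁ p) (inj₁ q) = inj₁ (<-trans p q)
    ≤-trans (inj₁ p) (inj₂ refl) = inj₁ p
    ≤-trans (inj₂ refl) q = q

    ≤-<-trans : ∀ {x y z} → x ≤ y → y < z → x < z
    ≤-<-trans (inj₁ p) q = <-trans p q
    ≤-<-trans (inj₂ refl) q = q

    <-≤-trans : ∀ {x y z} → x < y → y ≤ z → x < z
    <-≤-trans p (inj₁ q) = <-trans p q
    <-≤-trans p (inj₂ refl) = p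

    x≤max : ∀ x y → x ≤ max x y
    x≤max x y with compare x y
    ... | tri< p _ _ = inj₁ p
    ... | tri≈ _ _ _ = inj₂ refl
    ... | tri> _ _ _ = inj₂ refl

    y≤max : ∀ x y → y ≤ max x y
    y≤max x y with compare x y
    ... | tri< _ _ _ = inj₂ refl
    ... | tri≈ _ p _ = inj₂ (sym p)
    ... | tri> _ _ p = inj₁ p

    max-< : ∀ {x y d} → x < d → y < d → max x y < d
    max-< {x} {y} p q with compare x y
    ... | tri< _ _ _ = q
    ... | tri≈ _ _ _ = p
    ... | tri> _ _ _ = p

    Upto : Carrier → Set
    Upto m = Sub (_≤ m)

    Upto↣ : ∀ m → Upto m ↣ (Below m ⊎ ℕ)
    Upto↣ m = mk↣ {to = λ (x , x≤m) → f x ∣ x≤m ∣⁻} λ {x} {y} eq → Sub-≡ (inj (proj₁ x) (proj₁ y) _ _ eq)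
      where
      f : ∀ x → x ≤ m → Below m ⊎ ℕ
      f x (inj₁ x<m) = inj₁ (x , ∣ x<m ∣⁺)
      f x (inj₂ _)   = inj₂ 0

      inj : ∀ x y p q → f x p ≡ f y q → x ≡ y
      inj x y (inj₁ _) (inj₁ _) eq = cong proj₁ (inj₁-injective eq)
      inj x y (inj₂ p) (inj₂ q) _  = trans p (sym q)

    Square : Set → Set
    Square A = (A × A) ↣ A

    -- Comparing by maximum first confines the predecessors of a pair to the square of the segment
    -- up to its maximum; the coordinates themselves break ties.
    gödel : ∀ d → (Below d × Below d) ↣ (Carrier × Carrier × Carrier)
    gödel d = mk↣ {to = λ (x , y) → max (proj₁ x) (proj₁ y) , proj₁ x , proj₁ y}
      λ eq → ≡.cong₂ _,_ (Sub-≡ (cong (proj₁ ∘ proj₂) eq)) (Sub-≡ (cong (proj₂ ∘ proj₂) eq))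

    -- Unless below d embeds into below e ⊎ ℕ for some e < d, initial segments of
    -- Gödel's order on pairs cannot be mapped onto below d, and so the pairs are
    -- injected into it greedily.  The summand ℕ spares a separate treatment of
    -- finite segments.
    below-square : ∀ d → Square (Below d ⊎ ℕ)
    below-square = WF.All.wfRec wellFounded _ (λ d → Square (Below d ⊎ ℕ)) step
      where
      step : ∀ d → (∀ {e} → e < d → Square (Below e ⊎ ℕ)) → Square (Below d ⊎ ℕ)
      step d ih with em _ {Σ[ e ∈ Carrier ] (e < d × (Below d ↣ (Below e ⊎ ℕ)))}
      ... | yes (e , e<d , f) = (Below-mono e<d ⊎-↣ ↣-id ℕ) ∘↣ ih e<d ∘↣ (g ×-↣ g)
        where
        g : (Below d ⊎ ℕ) ↣ (Below e ⊎ ℕ)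
        g = absorb ∘↣ (f ⊎-↣ ↣-id ℕ)
      ... | no large with em _ {Below d}
      ...   | no empty = mk↣ {to = inj₂} inj₂-injective ∘↣ ℕ×ℕ↣ℕ ∘↣ (g ×-↣ g)
        where
        g : (Below d ⊎ ℕ) ↣ ℕ
        g = mk↣ {to = [ (λ b → ⊥-elim (empty b)) , id ]} λ
          { {inj₁ b} → ⊥-elim (empty b)
          ; {inj₂ _} {inj₁ b} → ⊥-elim (empty b)
          ; {inj₂ _} {inj₂ _} refl → refl }
      ...   | yes b₀ = mk↣ {to = inj₁} inj₁-injective ∘↣ square ∘↣ (Z↣B ×-↣ Z↣B)
        where
        section : ∀ {S : Set} {H : S → Below d} {Q : S → Set} →
                  (∀ b → ∃[ s ] (Q s × H s ≡ b)) → Below d ↣ Sub Q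
        section {H = H} onto = mk↣ {to = λ b → proj₁ (onto b) , ∣ proj₁ (proj₂ (onto b)) ∣⁺} λ {b} {c} eq →
          trans (sym (proj₂ (proj₂ (onto b)))) (trans (cong (H ∘ proj₁) eq) (proj₂ (proj₂ (onto c))))

        ℕ↣B : ℕ ↣ Below d
        ℕ↣B = inject-wellOrder ℕ-wellOrder b₀ λ n H onto →
          -- Any element below `d` serves as `e`: a finite segment mapped onto `Below d` would embed
          -- `Below d` into the summand ℕ alone.
          large (proj₁ b₀ , ∣ proj₂ b₀ ∣⁻ ,
            mk↣ {to = inj₂} inj₂-injective ∘↣ mk↣ {to = proj₁} Sub-≡ ∘↣ section {H = H} onto)

        square : Square (Below d)
        square = inject-wellOrder (pullback (W ×ₗ W ×ₗ W) (gödel d)) b₀ λ w H onto →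
          -- A map from the predecessors of `w` onto `Below d` has a section into the square of
          -- `Upto (top w)`, which the induction hypothesis compresses into `Below (top w) ⊎ ℕ`.
          large (top w , top<d w ,
            ih (top<d w) ∘↣ (Upto↣ (top w) ×-↣ Upto↣ (top w)) ∘↣ bounded w ∘↣ section {H = H} onto)
          where
          open WellOrder (pullback (W ×ₗ W ×ₗ W) (gödel d)) using () renaming (_<_ to _≺_)
          top : Below d × Below d → Carrier
          top ((x , _) , (y , _)) = max x y

          top<d : ∀ w → top w < d
          top<d ((x , x<d) , (y , y<d)) = max-< ∣ x<d ∣⁻ ∣ y<d ∣⁻

          top≤ : ∀ {v w} → v ≺ w → top v ≤ top w
          top≤ (inj₁ lt)       = inj₁ lt
          top≤ (inj₂ (eq , _)) = inj₂ eq

          bounded : ∀ w → Sub (_≺ w) ↣ (Upto (top w) × Upto (top w))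
          bounded w = mk↣
            {to = λ (v@((x , _) , (y , _)) , v≺w) →
              (x , ∣ ≤-trans (x≤max x y) (top≤ {v} {w} ∣ v≺w ∣⁻) ∣⁺) ,
                (y , ∣ ≤-trans (y≤max x y) (top≤ {v} {w} ∣ v≺w ∣⁻) ∣⁺)}
            λ {v} {v′} eq → Sub-≡ (≡.cong₂ _,_ (Sub-≡ (cong (proj₁ ∘ proj₁) eq)) (Sub-≡ (cong (proj₁ ∘ proj₂) eq)))

        Z↣B : (Below d ⊎ ℕ) ↣ Below d
        Z↣B = square ∘↣ mk↣ {to = f} inj
          where
          f : Below d ⊎ ℕ → Below d × Below d
          f (inj₁ b) = b , to ℕ↣B 0
          f (inj₂ n) = to ℕ↣B n , to ℕ↣B 1

          inj : ∀ {x y} → f x ≡ f y → x ≡ y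
          inj {inj₁ _} {inj₁ _} eq = cong (inj₁ ∘ proj₁) eq
          inj {inj₁ _} {inj₂ _} eq with () ← injective ℕ↣B (cong proj₂ eq)
          inj {inj₂ _} {inj₁ _} eq with () ← injective ℕ↣B (cong proj₂ eq)
          inj {inj₂ m} {inj₂ n} eq = cong inj₂ (injective ℕ↣B (cong proj₁ eq))

    below-trees : ∀ d → Tree (Below d ⊎ ℕ) ↣ (Below d ⊎ ℕ)
    below-trees d = Tree↣ (below-square d) {inj₂ 0} {inj₂ 1} λ ()

  interleave : (ℕ → Bool) → (ℕ → Bool) → ℕ → Bool
  interleave x y zero    = x 0
  interleave x y (suc n) = interleave y (x ∘ suc) n

  interleave-even : ∀ x y n → interleave x y (n ℕ.+ n) ≡ x n
  interleave-even x y zero = refl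
  interleave-even x y (suc n) rewrite ℕP.+-suc n n = interleave-even (x ∘ suc) (y ∘ suc) n

  interleave-odd : ∀ x y n → interleave x y (suc (n ℕ.+ n)) ≡ y n
  interleave-odd x y n = interleave-even y (x ∘ suc) n

  interleave-cong : ∀ {x x′ y y′} → (∀ n → x n ≡ x′ n) → (∀ n → y n ≡ y′ n) →
                    ∀ n → interleave x y n ≡ interleave x′ y′ n
  interleave-cong x≗x′ y≗y′ zero    = x≗x′ 0
  interleave-cong x≗x′ y≗y′ (suc n) = interleave-cong y≗y′ (x≗x′ ∘ suc) n

  -- 2^ω embeds into the complement of any countable set: fix a second coordinate
  -- that diagonalises against the points sent to ℕ.
  2^ω≰⊎ℕ : {A : Set} → ¬ (2^ω ≤ᶜ ≡.setoid A) → ¬ (2^ω ≤ᶜ ≡.setoid (A ⊎ ℕ))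
  2^ω≰⊎ℕ {A} A-small f = A-small (record
    { to        = λ x → proj₁ (left x)
    ; cong      = λ {x} {x′} x≗x′ → inj₁-injective (trans (sym (proj₂ (left x)))
                    (trans (F.cong (interleave-cong x≗x′ λ _ → refl)) (proj₂ (left x′))))
    ; injective = λ {x} {x′} eq n → trans (sym (interleave-even x diagonal n)) (trans
                    (F.injective (trans (proj₂ (left x)) (trans (cong inj₁ eq) (sym (proj₂ (left x′))))) (n ℕ.+ n))
                    (interleave-even x′ diagonal n))
    })
    where
    module F = Injection f

    preimage : ℕ → ℕ → Bool
    preimage n = ε (λ z → F.to z ≡ inj₂ n) (λ _ → false)

    preimage-spec : ∀ {n z} → F.to z ≡ inj₂ n → F.to (preimage n) ≡ inj₂ n
    preimage-spec {n} {z} eq = ε-spec {P = λ z → F.to z ≡ inj₂ n} (z , eq)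

    diagonal : ℕ → Bool
    diagonal n = not (preimage n (suc (n ℕ.+ n)))

    left : ∀ x → ∃[ a ] F.to (interleave x diagonal) ≡ inj₁ a
    left x with F.to (interleave x diagonal) in eq
    ... | inj₁ a = a , refl
    ... | inj₂ n = ⊥-elim (not-¬ refl (trans
      (F.injective {preimage n} {interleave x diagonal} (trans (preimage-spec eq) (sym eq)) (suc (n ℕ.+ n)))
      (interleave-odd x diagonal n)))

-- First-order logic

Renames : ∀ {a} {A : Set a} {m n} → (Fin m → Fin n) → Vec A m → Vec A n → Set a
Renames σ ρ ρ′ = ∀ i → lookup ρ′ (σ i) ≡ lookup ρ i

module _ {L : Language} where

  module _ (M : Structure L) where
    open Structure M using (Carrier; _≈_; domain; fun; fun-cong; rel; rel-resp)
    private module M = Setoid (Structure.domain M)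

    mutual
      ⟦⟧-cong : ∀ {n} (t : Term L n) {ρ ρ′ : Vec Carrier n} → Pointwise _≈_ ρ ρ′ → ⟦_⟧ M t ρ ≈ ⟦_⟧ M t ρ′
      ⟦⟧-cong (var i)    ρ≈ρ′ = Pointwise.lookup ρ≈ρ′ i
      ⟦⟧-cong (app f ts) ρ≈ρ′ = fun-cong f (⟦⟧*-cong ts ρ≈ρ′)

      ⟦⟧*-cong : ∀ {n k} (ts : Vec (Term L n) k) {ρ ρ′ : Vec Carrier n} →
                 Pointwise _≈_ ρ ρ′ → Pointwise _≈_ (⟦_⟧* M ts ρ) (⟦_⟧* M ts ρ′)
      ⟦⟧*-cong []       ρ≈ρ′ = []
      ⟦⟧*-cong (t ∷ ts) ρ≈ρ′ = ⟦⟧-cong t ρ≈ρ′ ∷ ⟦⟧*-cong ts ρ≈ρ′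

    Sat-resp : ∀ {n} (φ : Formula L n) {ρ ρ′ : Vec Carrier n} → Pointwise _≈_ ρ ρ′ → Sat M φ ρ → Sat M φ ρ′
    Sat-resp (s ≈ᶠ t)    ρ≈ρ′ h = M.trans (M.sym (⟦⟧-cong s ρ≈ρ′)) (M.trans h (⟦⟧-cong t ρ≈ρ′))
    Sat-resp (relᶠ R ts) ρ≈ρ′ h = rel-resp R (⟦⟧*-cong ts ρ≈ρ′) h
    Sat-resp (¬ᶠ φ)      ρ≈ρ′ h = λ h′ → h (Sat-resp φ (Pointwise.sym M.sym ρ≈ρ′) h′)
    Sat-resp (φ ∧ᶠ ψ)    ρ≈ρ′ (h , k) = Sat-resp φ ρ≈ρ′ h , Sat-resp ψ ρ≈ρ′ k
    Sat-resp (∃ᶠ φ)      ρ≈ρ′ (x , h) = x , Sat-resp φ (M.refl ∷ ρ≈ρ′) h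

  lift : ∀ {m n} → (Fin m → Fin n) → Fin (suc m) → Fin (suc n)
  lift σ zero    = zero
  lift σ (suc i) = suc (σ i)

  mutual
    renameᵗ : ∀ {m n} → (Fin m → Fin n) → Term L m → Term L n
    renameᵗ σ (var i)    = var (σ i)
    renameᵗ σ (app f ts) = app f (renameᵗ* σ ts)

    renameᵗ* : ∀ {m n k} → (Fin m → Fin n) → Vec (Term L m) k → Vec (Term L n) k
    renameᵗ* σ []       = []
    renameᵗ* σ (t ∷ ts) = renameᵗ σ t ∷ renameᵗ* σ ts

  rename : ∀ {m n} → (Fin m → Fin n) → Formula L m → Formula L n
  rename σ (s ≈ᶠ t)    = renameᵗ σ s ≈ᶠ renameᵗ σ t
  rename σ (relᶠ R ts) = relᶠ R (renameᵗ* σ ts)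
  rename σ (¬ᶠ φ)      = ¬ᶠ rename σ φ
  rename σ (φ ∧ᶠ ψ)    = rename σ φ ∧ᶠ rename σ ψ
  rename σ (∃ᶠ φ)      = ∃ᶠ rename (lift σ) φ

  module _ (M : Structure L) where
    open Structure M using (Carrier; fun; rel)

    mutual
      ⟦renameᵗ⟧ : ∀ {m n σ} {ρ : Vec Carrier m} {ρ′ : Vec Carrier n} → Renames σ ρ ρ′ →
                  ∀ t → ⟦_⟧ M (renameᵗ σ t) ρ′ ≡ ⟦_⟧ M t ρ
      ⟦renameᵗ⟧ eq (var i)    = eq i
      ⟦renameᵗ⟧ {σ = σ} {ρ} {ρ′} eq (app f ts) = cong (fun f) (⟦renameᵗ*⟧ {σ = σ} {ρ} {ρ′} eq ts)

      ⟦renameᵗ*⟧ : ∀ {m n k σ} {ρ : Vec Carrier m} {ρ′ : Vec Carrier n} → Renames σ ρ ρ′ →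
                   ∀ (ts : Vec (Term L m) k) → ⟦_⟧* M (renameᵗ* σ ts) ρ′ ≡ ⟦_⟧* M ts ρ
      ⟦renameᵗ*⟧ eq []       = refl
      ⟦renameᵗ*⟧ {σ = σ} {ρ} {ρ′} eq (t ∷ ts) =
        ≡.cong₂ _∷_ (⟦renameᵗ⟧ {σ = σ} {ρ} {ρ′} eq t) (⟦renameᵗ*⟧ {σ = σ} {ρ} {ρ′} eq ts)

    lift-renames : ∀ {m n σ} {ρ : Vec Carrier m} {ρ′ : Vec Carrier n} {x} →
                   Renames σ ρ ρ′ → Renames (lift σ) (x ∷ ρ) (x ∷ ρ′)
    lift-renames eq zero    = refl
    lift-renames eq (suc i) = eq i

    Sat-rename : ∀ {m n σ} {ρ : Vec Carrier m} {ρ′ : Vec Carrier n} → Renames σ ρ ρ′ →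
                 ∀ φ → Sat M (rename σ φ) ρ′ ⇔ Sat M φ ρ
    Sat-rename {σ = σ} {ρ} {ρ′} eq (s ≈ᶠ t)
      rewrite ⟦renameᵗ⟧ {σ = σ} {ρ} {ρ′} eq s | ⟦renameᵗ⟧ {σ = σ} {ρ} {ρ′} eq t = mk⇔ id id
    Sat-rename {σ = σ} {ρ} {ρ′} eq (relᶠ R ts) rewrite ⟦renameᵗ*⟧ {σ = σ} {ρ} {ρ′} eq ts = mk⇔ id id
    Sat-rename {σ = σ} {ρ} {ρ′} eq (¬ᶠ φ) =
      let φ⇔ = Sat-rename {σ = σ} {ρ} {ρ′} eq φ in mk⇔ (_∘ Equivalence.from φ⇔) (_∘ Equivalence.to φ⇔)
    Sat-rename {σ = σ} {ρ} {ρ′} eq (φ ∧ᶠ ψ) =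
      let φ⇔ = Sat-rename {σ = σ} {ρ} {ρ′} eq φ
          ψ⇔ = Sat-rename {σ = σ} {ρ} {ρ′} eq ψ
      in mk⇔ (Product.map (Equivalence.to φ⇔) (Equivalence.to ψ⇔))
             (Product.map (Equivalence.from φ⇔) (Equivalence.from ψ⇔))
    Sat-rename {σ = σ} {ρ} {ρ′} eq (∃ᶠ φ) = mk⇔
      (λ (x , h) → x , Equivalence.to (Sat-rename (lift-renames {σ = σ} {ρ} {ρ′} eq) φ) h)
      (λ (x , h) → x , Equivalence.from (Sat-rename (lift-renames {σ = σ} {ρ} {ρ′} eq) φ) h)

  -- Coding of formulas

  module Coding (countable : CountableLanguage L) where

    mutual
      codeᵗ : ∀ {n} → Term L n → Tree ℕ
      codeᵗ (var i)    = leaf (toℕ i)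
      codeᵗ (app f ts) = leaf (to countable (inj₁ f)) · codeᵗ* ts

      codeᵗ* : ∀ {n k} → Vec (Term L n) k → Tree ℕ
      codeᵗ* []       = leaf 0
      codeᵗ* (t ∷ ts) = codeᵗ t · codeᵗ* ts

    code : ∀ {n} → Formula L n → Tree ℕ
    code (s ≈ᶠ t)    = leaf 0 · codeᵗ s · codeᵗ t
    code (relᶠ R ts) = leaf 1 · leaf (to countable (inj₂ R)) · codeᵗ* ts
    code (¬ᶠ φ)      = leaf 2 · code φ
    code (φ ∧ᶠ ψ)    = leaf 3 · code φ · code ψ
    code (∃ᶠ φ)      = leaf 4 · code φ

    mutual
      codeᵗ-injective : ∀ {n} (s t : Term L n) → codeᵗ s ≡ codeᵗ t → s ≡ t
      codeᵗ-injective (var i) (var j) eq = cong var (toℕ-injective (leaf-injective eq))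
      codeᵗ-injective (app f ts) (app g us) eq
        with refl ← inj₁-injective (injective countable (leaf-injective (proj₁ (·-injective eq))))
        = cong (app f) (codeᵗ*-injective ts us (proj₂ (·-injective eq)))

      codeᵗ*-injective : ∀ {n k} (ts us : Vec (Term L n) k) → codeᵗ* ts ≡ codeᵗ* us → ts ≡ us
      codeᵗ*-injective []       []       _  = refl
      codeᵗ*-injective (t ∷ ts) (u ∷ us) eq = ≡.cong₂ _∷_
        (codeᵗ-injective t u (proj₁ (·-injective eq))) (codeᵗ*-injective ts us (proj₂ (·-injective eq)))

    code-injective : ∀ {n} (φ ψ : Formula L n) → code φ ≡ code ψ → φ ≡ ψ
    code-injective (s ≈ᶠ t) (u ≈ᶠ v) eq = let eq′ = ·-injective (proj₂ (·-injective eq)) in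
      ≡.cong₂ _≈ᶠ_ (codeᵗ-injective s u (proj₁ eq′)) (codeᵗ-injective t v (proj₂ eq′))
    code-injective (relᶠ R ts) (relᶠ S us) eq
      with eq′ ← ·-injective (proj₂ (·-injective eq))
      with refl ← inj₂-injective (injective countable (leaf-injective (proj₁ eq′)))
      = cong (relᶠ R) (codeᵗ*-injective ts us (proj₂ eq′))
    code-injective (¬ᶠ φ) (¬ᶠ ψ) eq = cong ¬ᶠ_ (code-injective φ ψ (proj₂ (·-injective eq)))
    code-injective (φ ∧ᶠ χ) (ψ ∧ᶠ ω) eq = let eq′ = ·-injective (proj₂ (·-injective eq)) in
      ≡.cong₂ _∧ᶠ_ (code-injective φ ψ (proj₁ eq′)) (code-injective χ ω (proj₂ eq′))
    code-injective (∃ᶠ φ) (∃ᶠ ψ) eq = cong ∃ᶠ_ (code-injective φ ψ (proj₂ (·-injective eq)))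
    code-injective (_ ≈ᶠ _) (relᶠ _ _) ()
    code-injective (_ ≈ᶠ _) (¬ᶠ _) ()
    code-injective (_ ≈ᶠ _) (_ ∧ᶠ _) ()
    code-injective (_ ≈ᶠ _) (∃ᶠ _) ()
    code-injective (relᶠ _ _) (_ ≈ᶠ _) ()
    code-injective (relᶠ _ _) (¬ᶠ _) ()
    code-injective (relᶠ _ _) (_ ∧ᶠ _) ()
    code-injective (relᶠ _ _) (∃ᶠ _) ()
    code-injective (¬ᶠ _) (_ ≈ᶠ _) ()
    code-injective (¬ᶠ _) (relᶠ _ _) ()
    code-injective (¬ᶠ _) (_ ∧ᶠ _) ()
    code-injective (¬ᶠ _) (∃ᶠ _) ()
    code-injective (_ ∧ᶠ _) (_ ≈ᶠ _) ()
    code-injective (_ ∧ᶠ _) (relᶠ _ _) ()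
    code-injective (_ ∧ᶠ _) (¬ᶠ _) ()
    code-injective (_ ∧ᶠ _) (∃ᶠ _) ()
    code-injective (∃ᶠ _) (_ ≈ᶠ _) ()
    code-injective (∃ᶠ _) (relᶠ _ _) ()
    code-injective (∃ᶠ _) (¬ᶠ _) ()
    code-injective (∃ᶠ _) (_ ∧ᶠ _) ()

  Agree : (M N : Structure L) → ∀ {n} → Vec (Structure.Carrier M) n → Vec (Structure.Carrier N) n →
          Formula L n → Set
  Agree M N ρ ρ′ φ = Sat M φ ρ ⇔ Sat N φ ρ′

  -- The conjunctions that contain each formula of the list or its negation. The equation
  -- `var zero ≈ᶠ var zero` serves as truth.
  patterns : ∀ {n} → List (Formula L (suc n)) → List (Formula L (suc n))
  patterns []      = (var zero ≈ᶠ var zero) ∷ []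
  patterns (φ ∷ Φ) = List.map (φ ∧ᶠ_) (patterns Φ) List.++ List.map ((¬ᶠ φ) ∧ᶠ_) (patterns Φ)

  patterns-agree : (M N : Structure L) → ∀ {n} {ρ ρ′} (Φ : List (Formula L (suc n))) {χ} →
                   χ ∈ patterns Φ → Sat M χ ρ → Sat N χ ρ′ → Allᴸ (Agree M N ρ ρ′) Φ
  patterns-agree M N []      _   _ _ = []ᴸ
  patterns-agree M N (φ ∷ Φ) χ∈ h h′ with ∈-++⁻ (List.map (φ ∧ᶠ_) (patterns Φ)) χ∈
  ... | inj₁ χ∈ with _ , ψ∈ , refl ← ∈-map⁻ (φ ∧ᶠ_) χ∈ =
    mk⇔ (λ _ → proj₁ h′) (λ _ → proj₁ h) ∷ᴸ patterns-agree M N Φ ψ∈ (proj₂ h) (proj₂ h′)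
  ... | inj₂ χ∈ with _ , ψ∈ , refl ← ∈-map⁻ ((¬ᶠ φ) ∧ᶠ_) χ∈ =
    mk⇔ (⊥-elim ∘ proj₁ h) (⊥-elim ∘ proj₁ h′) ∷ᴸ patterns-agree M N Φ ψ∈ (proj₂ h) (proj₂ h′)

-- Witnesses and Skolem hulls

module Models (em : ∀ ℓ → ExcludedMiddle ℓ)
              (ac : ∀ a ℓ₁ b ℓ₂ r → AxiomOfChoice a ℓ₁ b ℓ₂ r)
              {L : Language} where
  open Classical em
  open Choice em ac

  patterns-exhaust : (M : Structure L) → ∀ {n} ρ (Φ : List (Formula L (suc n))) →
                     ∃[ χ ] (χ ∈ patterns Φ × Sat M χ ρ)
  patterns-exhaust M (x ∷ ρ) []      = _ , here refl , Setoid.refl (Structure.domain M)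
  patterns-exhaust M ρ       (φ ∷ Φ) with patterns-exhaust M ρ Φ | em _ {Sat M φ ρ}
  ... | χ , χ∈ , h | yes φ-holds = _ , ∈-++⁺ˡ (∈-map⁺ (φ ∧ᶠ_) χ∈) , φ-holds , h
  ... | χ , χ∈ , h | no φ-fails  = _ , ∈-++⁺ʳ _ (∈-map⁺ ((¬ᶠ φ) ∧ᶠ_) χ∈) , φ-fails , h

  -- `x` satisfies some pattern `χ`. Agreement on `∃ᶠ χ` moves it to `N`, and any two elements with
  -- the same pattern agree on `Φ`. The formula `χ` is returned instead of one witness, so that the
  -- witness can be taken from a countable set.
  extend-agreement : (M N : Structure L) → ∀ {n} {ρ ρ′} (Φ : List (Formula L (suc n))) →
    Allᴸ (Agree M N ρ ρ′) (List.map ∃ᶠ_ (patterns Φ)) →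
    ∀ x → ∃[ χ ] (Sat N (∃ᶠ χ) ρ′ × (∀ y → Sat N χ (y ∷ ρ′) → Allᴸ (Agree M N (x ∷ ρ) (y ∷ ρ′)) Φ))
  extend-agreement M N {ρ = ρ} Φ agree x with patterns-exhaust M (x ∷ ρ) Φ
  ... | χ , χ∈ , h = χ , Equivalence.to (ListAll.lookup agree (∈-map⁺ ∃ᶠ_ χ∈)) (x , h) ,
    λ y h′ → patterns-agree M N Φ χ∈ h h′

  module Skolem (countable : CountableLanguage L) (M : Structure L) (m₀ : Structure.Carrier M) where
    open Structure M using (Carrier; _≈_; domain)
    open Coding {L} countable
    private module M = Setoid (Structure.domain M)

    private
      rep : Carrier → Carrier
      rep = proj₁ (representatives domain)

      ≈-rep* : ∀ {n} (ρ : Vec Carrier n) → Pointwise _≈_ ρ (Vec.map rep ρ)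
      ≈-rep* []      = []
      ≈-rep* (x ∷ ρ) = proj₂ (proj₂ (representatives domain)) x ∷ ≈-rep* ρ

      rep*-cong : ∀ {n} {ρ ρ′ : Vec Carrier n} → Pointwise _≈_ ρ ρ′ → Vec.map rep ρ ≡ Vec.map rep ρ′
      rep*-cong []           = refl
      rep*-cong (x≈y ∷ ρ≈ρ′) = ≡.cong₂ _∷_ (proj₁ (proj₂ (representatives domain)) x≈y) (rep*-cong ρ≈ρ′)

    -- Parameters are first replaced by representatives, since `ε` applied to merely equivalent
    -- predicates may choose different elements.
    skolem : ∀ {n} → Formula L (suc n) → Vec Carrier n → Carrier
    skolem φ ρ = ε (λ x → Sat M φ (x ∷ Vec.map rep ρ)) m₀

    skolem-cong : ∀ {n} φ {ρ ρ′ : Vec Carrier n} → Pointwise _≈_ ρ ρ′ → skolem φ ρ ≡ skolem φ ρ′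
    skolem-cong φ ρ≈ρ′ = cong (λ ρ → ε (λ x → Sat M φ (x ∷ ρ)) m₀) (rep*-cong ρ≈ρ′)

    skolem-spec : ∀ {n} φ {ρ : Vec Carrier n} → Sat M (∃ᶠ φ) ρ → Sat M φ (skolem φ ρ ∷ ρ)
    skolem-spec φ {ρ} (x , h) = Sat-resp M φ (M.refl ∷ Pointwise.sym M.sym (≈-rep* ρ))
      (ε-spec {P = λ x → Sat M φ (x ∷ Vec.map rep ρ)} (x , Sat-resp M φ (M.refl ∷ ≈-rep* ρ) h))

    data Hull (P : Pred Carrier 0ℓ) : Pred Carrier 0ℓ where
      base   : ∀ {x} → P x → Hull P x
      closed : ∀ {n} φ {ρ : Vec Carrier n} → All (Hull P) ρ → Hull P (skolem φ ρ)

    mutual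
      hull-mono : ∀ {P Q} → P ⊆ Q → Hull P ⊆ Hull Q
      hull-mono P⊆Q (base x∈P)    = base (P⊆Q x∈P)
      hull-mono P⊆Q (closed φ ρ∈) = closed φ (hull-mono* P⊆Q ρ∈)

      hull-mono* : ∀ {P Q n} {ρ : Vec Carrier n} → P ⊆ Q → All (Hull P) ρ → All (Hull Q) ρ
      hull-mono* P⊆Q []        = []
      hull-mono* P⊆Q (x∈ ∷ ρ∈) = hull-mono P⊆Q x∈ ∷ hull-mono* P⊆Q ρ∈

    -- An element of the hull is named by a tree that spells out a Skolem term.
    module _ {P : Pred Carrier 0ℓ} (u : ℕ → Carrier) (u∈P : ∀ k → P (u k))
             (P⊆u : ∀ {x} → P x → ∃[ k ] u k ≈ x) where
      private
        symbol : ∃[ n ] Formula L (suc n) → Tree ℕ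
        symbol (n , φ) = leaf n · code φ

        unsymbol : Tree ℕ → ∃[ n ] Formula L (suc n)
        unsymbol t = ε (λ s → symbol s ≡ t) (0 , (var zero ≈ᶠ var zero))

        symbol-injective : ∀ s s′ → symbol s ≡ symbol s′ → s ≡ s′
        symbol-injective (n , φ) (n′ , φ′) eq with refl ← leaf-injective (proj₁ (·-injective eq)) =
          cong (n ,_) (code-injective φ φ′ (proj₂ (·-injective eq)))

        unsymbol-symbol : ∀ s → unsymbol (symbol s) ≡ s
        unsymbol-symbol s = symbol-injective _ s (ε-spec {P = λ s′ → symbol s′ ≡ symbol s} (s , refl))

        mutual
          value : Tree ℕ → Carrier
          value (leaf k) = u k
          value (s · t)  = skolem (proj₂ (unsymbol s)) (values _ t)

          values : ∀ n → Tree ℕ → Vec Carrier n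
          values zero    _        = []
          -- A tree with too few branches is padded with `u k`, so that every tree names a member of
          -- the hull.
          values (suc n) (leaf k) = u k ∷ values n (leaf k)
          values (suc n) (s · t)  = value s ∷ values n t

        mutual
          value∈hull : ∀ t → Hull P (value t)
          value∈hull (leaf k) = base (u∈P k)
          value∈hull (s · t)  = closed (proj₂ (unsymbol s)) (values∈hull _ t)

          values∈hull : ∀ n t → All (Hull P) (values n t)
          values∈hull zero    _        = []
          values∈hull (suc n) (leaf k) = base (u∈P k) ∷ values∈hull n (leaf k)
          values∈hull (suc n) (s · t)  = value∈hull s ∷ values∈hull n t

        mutual
          hull⊆value : ∀ {x} → Hull P x → ∃[ t ] value t ≈ x
          hull⊆value (base x∈P) = let k , uk≈x = P⊆u x∈P in leaf k , uk≈x
          hull⊆value (closed {n} φ {ρ} ρ∈) = let t , eq = hull*⊆values ρ∈ in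
            symbol (n , φ) · t , M.reflexive (trans
              (cong (λ s → skolem (proj₂ s) (values _ t)) (unsymbol-symbol (n , φ))) (skolem-cong φ eq))

          hull*⊆values : ∀ {n} {ρ : Vec Carrier n} → All (Hull P) ρ → ∃[ t ] Pointwise _≈_ (values n t) ρ
          hull*⊆values []        = leaf 0 , []
          hull*⊆values (x∈ ∷ ρ∈) = let s , p = hull⊆value x∈; t , q = hull*⊆values ρ∈ in s · t , p ∷ q

      hull-countable : Σ[ c ∈ (ℕ → Carrier) ] ((∀ k → Hull P (c k)) × (∀ {x} → Hull P x → ∃[ k ] c k ≈ x))
      hull-countable = value ∘ tree , value∈hull ∘ tree , λ x∈ →
        let t , eq = hull⊆value x∈ in to Treeℕ↣ℕ t , M.trans (M.reflexive (cong value (tree-to t))) eq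
        where
        tree : ℕ → Tree ℕ
        tree k = ε (λ t → to Treeℕ↣ℕ t ≡ k) (leaf 0)

        tree-to : ∀ t → tree (to Treeℕ↣ℕ t) ≡ t
        tree-to t = injective Treeℕ↣ℕ (ε-spec {P = λ t′ → to Treeℕ↣ℕ t′ ≡ to Treeℕ↣ℕ t} (t , refl))

-- Ultrafilters and ultrapowers

module FiniteCharacter (em : ∀ ℓ → ExcludedMiddle ℓ)
                       (ac : ∀ a ℓ₁ b ℓ₂ r → AxiomOfChoice a ℓ₁ b ℓ₂ r)
                       (W : WellOrder) where
  open Classical em
  open Choice em ac
  open Segments W using (_≤_; ≤-trans; ≤-<-trans)
  open WellOrder W

  private
    maximum : ∀ {n} (α : Vec Carrier (suc n)) → ∃[ i ] All (_≤ lookup α i) α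
    maximum (x ∷ [])    = zero , inj₂ refl ∷ []
    maximum (x ∷ y ∷ α) with maximum (y ∷ α)
    ... | i , α≤ with compare x (lookup (y ∷ α) i)
    ...   | tri< x< _ _ = suc i , inj₁ x< ∷ α≤
    ...   | tri≈ _ x≡ _ = suc i , inj₂ x≡ ∷ α≤
    ...   | tri> _ _ <x = zero , inj₂ refl ∷ All.map (λ z≤ → ≤-trans z≤ (inj₁ <x)) α≤

    -- All occurrences of the maximum `s` are merged into position 0 by `σ`; what remains lies
    -- strictly below `s`.
    split : ∀ s {n} (α : Vec Carrier n) → All (_≤ s) α →
            ∃[ m ] Σ[ β ∈ Vec Carrier m ] (All (_< s) β × Σ[ σ ∈ (Fin n → Fin (suc m)) ] Renames σ α (s ∷ β))
    split s []      []         = 0 , [] , [] , (λ ()) , λ ()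
    split s (x ∷ α) (x≤s ∷ α≤s) with split s α α≤s
    split s (x ∷ α) (inj₂ refl ∷ _) | m , β , β<s , σ , eq =
      m , β , β<s , (λ { zero → zero ; (suc i) → σ i }) , λ { zero → refl ; (suc i) → eq i }
    split s (x ∷ α) (inj₁ x<s ∷ _)  | m , β , β<s , σ , eq =
      suc m , x ∷ β , x<s ∷ β<s , (λ { zero → suc zero ; (suc i) → shift (σ i) }) ,
      λ { zero → refl ; (suc i) → trans (shift-lookup (σ i)) (eq i) }
      where
      shift : ∀ {m} → Fin (suc m) → Fin (suc (suc m))
      shift zero    = zero
      shift (suc j) = suc (suc j)
      shift-lookup : ∀ j → lookup (s ∷ x ∷ β) (shift j) ≡ lookup (s ∷ β) j
      shift-lookup zero    = refl
      shift-lookup (suc j) = refl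

  module _ {a p q} {R : Set a} (r₀ : R) (P : Carrier → R → Set p)
           (Q : ∀ {n} → Vec R n → Set q)
           (Q-rename : ∀ {m n} (σ : Fin m → Fin n) ρ ρ′ → Renames σ ρ ρ′ → Q ρ′ → Q ρ)
           (Q-[] : Q [])
           (extend : ∀ t (h : Carrier → R) → (∀ {s} → s < t → P s (h s)) →
                     (∀ {n} (α : Vec Carrier n) → All (_< t) α → Q (Vec.map h α)) →
                     ∃[ r ] (P t r × (∀ {n} (α : Vec Carrier n) → All (_< t) α → Q (r ∷ Vec.map h α))))
           where
    private
      Good : Carrier → (Carrier → R) → Set _
      Good t h = (∀ {s} → s < t → P s (h s)) ×
                 (∀ {n} (α : Vec Carrier n) → All (_< t) α → Q (Vec.map h α))

      Fits : Carrier → (Carrier → R) → R → Set _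
      Fits t h r = P t r × (∀ {n} (α : Vec Carrier n) → All (_< t) α → Q (r ∷ Vec.map h α))

      map-agree : ∀ {t} {h h′ : Carrier → R} {n} (α : Vec Carrier n) → (∀ s → s < t → h s ≡ h′ s) → All (_< t) α →
                  Vec.map h α ≡ Vec.map h′ α
      map-agree []      _    []           = refl
      map-agree (x ∷ α) h≡h′ (x<t ∷ α<t) = ≡.cong₂ _∷_ (h≡h′ x x<t) (map-agree α h≡h′ α<t)

      local : ∀ t {h h′ r} → (∀ s → s < t → h s ≡ h′ s) →
              (Good t h → Fits t h r) → Good t h′ → Fits t h′ r
      local t {r = r} h≡h′ fits (good , good*)
        with fits ((λ {s} s<t → subst (P s) (sym (h≡h′ _ s<t)) (good s<t)) ,
                   (λ α α<t → subst Q (sym (map-agree α h≡h′ α<t)) (good* α α<t)))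
      ... | Ptr , Q∷ = Ptr , λ α α<t → subst Q (cong (r ∷_) (map-agree α h≡h′ α<t)) (Q∷ α α<t)

      -- `wf-choice` demands an answer to every history, so the requirement is conditional on the
      -- history being good. That the actual history is good is proved afterwards by induction.
      respond : ∀ t h → ∃[ r ] (Good t h → Fits t h r)
      respond t h with em _ {Good t h}
      ... | yes good = let r , fits = extend t h (proj₁ good) (proj₂ good) in r , λ _ → fits
      ... | no ¬good = r₀ , λ good → ⊥-elim (¬good good)

    abstract
      -- An arbitrary tuple is, up to renaming, its maximum followed by strictly smaller entries.
      -- The step taken at the maximum has secured `Q` for that tuple, and `Q-rename` carries it
      -- over.
      coherent : Σ[ h ∈ (Carrier → R) ] ((∀ t → P t (h t)) × (∀ {n} (α : Vec Carrier n) → Q (Vec.map h α)))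
      coherent with wf-choice W (λ t h r → Good t h → Fits t h r) local r₀ respond
      ... | h , fits = h , (λ t → proj₁ (fits t (good t))) , λ α → Q-map α λ i → good (lookup α i)
        where
        Q-map : ∀ {n} (α : Vec Carrier n) → (∀ i → Good (lookup α i) h) → Q (Vec.map h α)
        Q-map []        _       = Q-[]
        Q-map α@(_ ∷ _) α-good with maximum α
        ... | i , α≤ with split (lookup α i) α α≤
        ...   | m , β , β< , σ , eq = Q-rename σ _ _ renames (proj₂ (fits (lookup α i) (α-good i)) β β<)
          where
          renames : Renames σ (Vec.map h α) (Vec.map h (lookup α i ∷ β))
          renames j = trans (lookup-map (σ j) h (lookup α i ∷ β)) (trans (cong h (eq j)) (sym (lookup-map j h α)))

        good : ∀ t → Good t h
        good = WF.All.wfRec wellFounded _ (λ t → Good t h) λ t ih →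
          (λ s<t → proj₁ (fits _ (ih s<t))) ,
          (λ α α<t → Q-map α λ i → ih (AllP.lookup⁺ α<t i))

  module _ (X : Carrier → ℕ → Bool) (X-surjective : ∀ (x : ℕ → Bool) → ∃[ t ] (∀ k → X t k ≡ x k))
           {B : Set} (E : B → Pred ℕ 0ℓ) (b₀ : B) (E-nonempty : ∀ b → ∃ (E b))
           (E-directed : ∀ b c → ∃[ d ] (E d ⊆ E b × E d ⊆ E c))
           where
    private
      Meets : ∀ {n} → Vec (ℕ → Bool) n → Set
      Meets ρ = ∀ b → ∃[ k ] (E b k × (∀ i → lookup ρ i k ≡ true))

      Decides : Carrier → (ℕ → Bool) → Set
      Decides t r = (∀ k → r k ≡ X t k) ⊎ (∀ k → r k ≡ not (X t k))

      both : ∀ {h : Carrier → ℕ → Bool} {m n k} (α : Vec Carrier m) (β : Vec Carrier n) →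
             (∀ i → lookup (Vec.map h (α ++ β)) i k ≡ true) →
             (∀ i → lookup (Vec.map h α) i k ≡ true) × (∀ i → lookup (Vec.map h β) i k ≡ true)
      both {h} {m} {n} {k} α β all =
        (λ i → trans (cong (λ r → r k) (trans (lookup-map i h α) (sym (trans (lookup-map (i ↑ˡ n) h (α ++ β))
                 (cong h (lookup-++ˡ α β i)))))) (all (i ↑ˡ n))) ,
        (λ i → trans (cong (λ r → r k) (trans (lookup-map i h β) (sym (trans (lookup-map (m ↑ʳ i) h (α ++ β))
                 (cong h (lookup-++ʳ α β i)))))) (all (m ↑ʳ i)))

      -- If the complement of `X t` fails with `β` and `c`, then `X t` succeeds with every `α` and
      -- `b`: some `k` in a common refinement of `b` and `c` meets `α ++ β`, and it cannot lie in
      -- the complement.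
      decide : ∀ t (h : Carrier → ℕ → Bool) → (∀ {s} → s < t → Decides s (h s)) →
               (∀ {n} (α : Vec Carrier n) → All (_< t) α → Meets (Vec.map h α)) →
               ∃[ r ] (Decides t r × (∀ {n} (α : Vec Carrier n) → All (_< t) α → Meets (r ∷ Vec.map h α)))
      decide t h _ meets with em _ {∀ {n} (α : Vec Carrier n) → All (_< t) α → Meets (X t ∷ Vec.map h α)}
      ... | yes X-meets = X t , inj₁ (λ _ → refl) , X-meets
      ... | no X-fails  = (λ k → not (X t k)) , inj₂ (λ _ → refl) , λ β β<t c → by-contradiction λ ∁X-fails →
        X-fails λ α α<t b →
          let d , d⊆b , d⊆c = E-directed b c
              k , k∈d , all = meets (α ++ β) (AllP.++⁺ α<t β<t) d
              allα , allβ   = both α β all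
          in k , d⊆b k∈d , λ { zero → by-contradiction λ X≢true →
                                 ∁X-fails (k , d⊆c k∈d , λ { zero → not-true X≢true ; (suc i) → allβ i })
                             ; (suc i) → allα i }
        where
        not-true : ∀ {b} → b ≢ true → not b ≡ true
        not-true {false} _  = refl
        not-true {true}  ne = ⊥-elim (ne refl)

      Meets-rename : ∀ {m n} (σ : Fin m → Fin n) ρ ρ′ → Renames σ ρ ρ′ → Meets ρ′ → Meets ρ
      Meets-rename σ _ _ eq meets b = let k , k∈b , all = meets b in
        k , k∈b , λ i → trans (cong (λ r → r k) (sym (eq i))) (all (σ i))

    -- `W` lists all subsets of ω. Each of them or its complement is added while every finite
    -- intersection still meets all `E b`; the filter generated in this way is decisive.
    extend-to-ultrafilter : Σ[ 𝓤 ∈ Ultrafilter ℕ ] (∀ b → Ultrafilter.Large 𝓤 (E b))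
    extend-to-ultrafilter
      with coherent (λ _ → false) Decides Meets Meets-rename
             (λ b → let k , k∈b = E-nonempty b in k , k∈b , λ ()) decide
    ... | h , decides , meets = record
      { Large    = λ A → ∥ Generates A ∥
      ; whole    = ∣ (0 , [] , b₀ , λ _ _ _ → _) ∣⁺
      ; proper   = λ ∅-large → let n , α , b , sub = ∣ ∅-large ∣⁻; k , k∈b , all = meets α b in sub k k∈b all
      ; upward   = λ A⊆B A-large → let n , α , b , sub = ∣ A-large ∣⁻ in
                     ∣ (n , α , b , λ k k∈b all → A⊆B (sub k k∈b all)) ∣⁺
      ; inter    = λ A-large B-large →
                     let m , α , b , sub  = ∣ A-large ∣⁻
                         n , β , c , sub′ = ∣ B-large ∣⁻
                         d , d⊆b , d⊆c    = E-directed b c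
                     in ∣ (m ℕ.+ n , α ++ β , d , λ k k∈d all →
                          sub k (d⊆b k∈d) (proj₁ (both α β all)) , sub′ k (d⊆c k∈d) (proj₂ (both α β all))) ∣⁺
      ; decisive = decisive
      } , λ b → ∣ (0 , [] , b , λ _ k∈b _ → k∈b) ∣⁺
      where
      Generates : Pred ℕ 0ℓ → Set
      Generates A = ∃[ n ] Σ[ α ∈ Vec Carrier n ] Σ[ b ∈ B ]
        (∀ k → E b k → (∀ i → lookup (Vec.map h α) i k ≡ true) → A k)

      decisive : ∀ A → ∥ Generates A ∥ ⊎ ∥ Generates (∁ A) ∥
      decisive A with X-surjective (λ k → does (em _ {A k}))
      ... | t , Xt≗A with decides t
      ...   | inj₁ h≗X = inj₁ ∣ (1 , t ∷ [] , b₀ , λ k _ all →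
              in-A k (trans (sym (Xt≗A k)) (trans (sym (h≗X k)) (all zero)))) ∣⁺
        where
        in-A : ∀ k → does (em _ {A k}) ≡ true → A k
        in-A k eq with em _ {A k}
        in-A k eq | yes a = a
      ...   | inj₂ h≗∁X = inj₂ ∣ (1 , t ∷ [] , b₀ , λ k _ all →
              not-in-A k (trans (cong not (sym (Xt≗A k))) (trans (sym (h≗∁X k)) (all zero)))) ∣⁺
        where
        not-in-A : ∀ k → not (does (em _ {A k})) ≡ true → ¬ A k
        not-in-A k eq with em _ {A k}
        not-in-A k eq | no ¬a = ¬a

-- From agreement on large sets to an isomorphism

module Transfer {L : Language} (M N : Structure L) (𝓤 : Ultrafilter ℕ) where
  open Ultrafilter 𝓤
  private
    module M where
      open Structure M public
      open Setoid domain public using (refl; sym; trans; reflexive)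
    module N where
      open Structure N public
      open Setoid domain public using (refl; sym; trans; reflexive)

  module _ {T : Set} (left : T → ℕ → M.Carrier) (right : T → ℕ → N.Carrier)
           (agree : ∀ {n} (α : Vec T n) φ →
                    Large (λ k → Agree M N (Vec.map (λ t → left t k) α) (Vec.map (λ t → right t k) α) φ))
           (left-surjective : ∀ (f : ℕ → M.Carrier) → ∃[ t ] (∀ k → left t k M.≈ f k))
           (right-surjective : ∀ (g : ℕ → N.Carrier) → ∃[ t ] (∀ k → right t k N.≈ g k))
           where
    private
      Matched : (ℕ → M.Carrier) → (ℕ → N.Carrier) → Set
      Matched f g = ∃[ t ] (∀ k → left t k M.≈ f k × right t k N.≈ g k)

      matches : ∀ {n} {fs : Vec (ℕ → M.Carrier) n} {gs : Vec (ℕ → N.Carrier) n} → Pointwise Matched fs gs →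
        Σ[ α ∈ Vec T n ] (∀ k → Pointwise M._≈_ (Vec.map (λ t → left t k) α) (at M 𝓤 k fs) ×
                                Pointwise N._≈_ (Vec.map (λ t → right t k) α) (at N 𝓤 k gs))
      matches []                = [] , λ k → [] , []
      matches ((t , eq) ∷ match) = let α , eqs = matches match in
        t ∷ α , λ k → (proj₁ (eq k) ∷ proj₁ (eqs k)) , (proj₂ (eq k) ∷ proj₂ (eqs k))

      transfer : ∀ {n} (φ : Formula L n) {fs gs} → Pointwise Matched fs gs →
                 Large (λ k → Sat M φ (at M 𝓤 k fs)) ⇔ Large (λ k → Sat N φ (at N 𝓤 k gs))
      transfer φ match with matches match
      ... | α , eqs = mk⇔
        (λ large → upward (λ {k} (ag , h) → Sat-resp N φ (proj₂ (eqs k))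
          (Equivalence.to ag (Sat-resp M φ (Pointwise.sym M.sym (proj₁ (eqs k))) h))) (inter (agree α φ) large))
        (λ large → upward (λ {k} (ag , h) → Sat-resp M φ (proj₁ (eqs k))
          (Equivalence.from ag (Sat-resp N φ (Pointwise.sym N.sym (proj₂ (eqs k))) h))) (inter (agree α φ) large))

      image : (ℕ → M.Carrier) → (ℕ → N.Carrier)
      image f = right (proj₁ (left-surjective f))

      matched : ∀ f → Matched f (image f)
      matched f = let t , eq = left-surjective f in t , λ k → eq k , N.refl

      matched* : ∀ {n} (fs : Vec (ℕ → M.Carrier) n) → Pointwise Matched fs (Vec.map image fs)
      matched* []       = []
      matched* (f ∷ fs) = matched f ∷ matched* fs

      -- Its two directions show that `image` respects equality in the ultrapower and is injective.
      -- Surjectivity follows by taking for the second pair a task whose right side is the given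
      -- `g`.
      equal : ∀ {f f′ g g′} → Matched f g → Matched f′ g′ → _~_ M 𝓤 f f′ ⇔ _~_ N 𝓤 g g′
      equal m m′ = transfer (var zero ≈ᶠ var (suc zero)) (m ∷ m′ ∷ [])

    ultrapowers-isomorphic : ultrapower M 𝓤 ≃ ultrapower N 𝓤
    ultrapowers-isomorphic = record
      { bijection = record
        { to        = image
        ; cong      = λ {f} {f′} → Equivalence.to (equal (matched f) (matched f′))
        ; bijective = (λ {f} {f′} → Equivalence.from (equal (matched f) (matched f′))) , λ g →
            let t , eq = right-surjective g in left t , λ {f} →
              Equivalence.to (equal (matched f) (t , λ k → M.refl , eq k))
        }
      -- The formula y = F(x₁, ..., xₙ) is transferred, with the sequence of values of `F` at `fs`
      -- as y; on the left it holds at every coordinate.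
      ; fun-pres = λ F fs → upward (λ h → N.trans h (N.reflexive (cong (N.fun F) (⟦variables⟧ N suc _ _ λ _ → refl))))
          (Equivalence.to
            (transfer (var zero ≈ᶠ app F (tabulate (var ∘ suc))) (matched (λ k → M.fun F (at M 𝓤 k fs)) ∷ matched* fs))
            (upward (λ _ → M.reflexive (cong (M.fun F) (sym (⟦variables⟧ M suc _ _ λ _ → refl)))) whole))
      ; rel-pres = λ S fs → mk⇔
          (λ large → upward (subst (N.rel S) (⟦variables⟧ N id _ _ λ _ → refl))
            (Equivalence.to (transfer (relᶠ S (tabulate var)) (matched* fs))
              (upward (subst (M.rel S) (sym (⟦variables⟧ M id _ _ λ _ → refl))) large)))
          (λ large → upward (subst (M.rel S) (⟦variables⟧ M id _ _ λ _ → refl))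
            (Equivalence.from (transfer (relᶠ S (tabulate var)) (matched* fs))
              (upward (subst (N.rel S) (sym (⟦variables⟧ N id _ _ λ _ → refl))) large)))
      }
      where
      ⟦variables⟧ : ∀ (K : Structure L) {m n} (σ : Fin m → Fin n) (ρ : Vec (Structure.Carrier K) m) ρ′ →
                    Renames σ ρ ρ′ → ⟦_⟧* K (tabulate (var ∘ σ)) ρ′ ≡ ρ
      ⟦variables⟧ K σ []      ρ′ eq = refl
      ⟦variables⟧ K σ (x ∷ ρ) ρ′ eq = ≡.cong₂ _∷_ (eq zero) (⟦variables⟧ K (σ ∘ suc) ρ ρ′ (eq ∘ suc))

-- The back-and-forth construction

module _ {L : Language} where

  module _ (M N : Structure L) {r} {R : Set r}
           (left : R → ℕ → Structure.Carrier M) (right : R → ℕ → Structure.Carrier N) where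

    AgreeAt : ℕ → ∀ {n} → Vec R n → List (Formula L n) → Set
    AgreeAt k ρ = Allᴸ (Agree M N (Vec.map (λ r → left r k) ρ) (Vec.map (λ r → right r k) ρ))

    -- Agreement beyond every `k₀` is both what `cohen-generic` asks of a requirement and what it
    -- delivers, so the invariant survives each step.
    OftenAgree : ∀ {n} → Vec R n → Set
    OftenAgree ρ = ∀ Φ k₀ → ∃[ k ] (k₀ ℕ.≤ k × AgreeAt k ρ Φ)

    AgreeAt-rename : ∀ {m n} (σ : Fin m → Fin n) ρ ρ′ → Renames σ ρ ρ′ → ∀ {k} Φ →
                     AgreeAt k ρ′ (List.map (rename σ) Φ) → AgreeAt k ρ Φ
    AgreeAt-rename σ ρ ρ′ eq Φ agree = ListAll.map
      (λ {φ} agree → renamed N (λ r → right r _) φ ⇔-∘ (agree ⇔-∘ ⇔-sym (renamed M (λ r → left r _) φ)))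
      (ListAllP.map⁻ agree)
      where
      renamed : ∀ (K : Structure L) (f : R → Structure.Carrier K) φ →
                Sat K (rename σ φ) (Vec.map f ρ′) ⇔ Sat K φ (Vec.map f ρ)
      renamed K f = Sat-rename K {σ = σ} {Vec.map f ρ} {Vec.map f ρ′} λ i →
        trans (lookup-map (σ i) f ρ′) (trans (cong f (eq i)) (sym (lookup-map i f ρ)))

    OftenAgree-rename : ∀ {m n} (σ : Fin m → Fin n) ρ ρ′ → Renames σ ρ ρ′ → OftenAgree ρ′ → OftenAgree ρ
    OftenAgree-rename σ ρ ρ′ eq often Φ k₀ =
      let k , k₀≤k , agree = often (List.map (rename σ) Φ) k₀ in
      k , k₀≤k , AgreeAt-rename σ ρ ρ′ eq Φ agree

  OftenAgree-sym : (M N : Structure L) → ∀ {r} {R : Set r} left right {n} (ρ : Vec R n) →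
                   OftenAgree M N left right ρ → OftenAgree N M right left ρ
  OftenAgree-sym M N left right ρ often Φ k₀ =
    let k , k₀≤k , agree = often Φ k₀ in k , k₀≤k , ListAll.map ⇔-sym agree

  module _ (countable : CountableLanguage L) where
    open Coding {L} countable

    context-code : ∀ {A : Set} → (∃[ n ] Vec A n × List (Formula L (suc n))) ↣ Tree (A ⊎ ℕ)
    context-code {A} = mk↣ {to = f} inj
      where
      vec : ∀ {n} → Vec A n → Tree (A ⊎ ℕ)
      vec []      = leaf (inj₂ 0)
      vec (x ∷ α) = leaf (inj₁ x) · vec α

      list : ∀ {n} → List (Formula L n) → Tree (A ⊎ ℕ)
      list []      = leaf (inj₂ 0)
      list (φ ∷ Φ) = leaf (inj₂ (to Treeℕ↣ℕ (code φ))) · list Φ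

      f : _ → _
      f (n , α , Φ) = leaf (inj₂ n) · vec α · list Φ

      vec-inj : ∀ {n} (α β : Vec A n) → vec α ≡ vec β → α ≡ β
      vec-inj []      []      _  = refl
      vec-inj (x ∷ α) (y ∷ β) eq = ≡.cong₂ _∷_
        (inj₁-injective (leaf-injective (proj₁ (·-injective eq)))) (vec-inj α β (proj₂ (·-injective eq)))

      list-inj : ∀ {n} (Φ Ψ : List (Formula L n)) → list Φ ≡ list Ψ → Φ ≡ Ψ
      list-inj []      []      _  = refl
      list-inj (φ ∷ Φ) (ψ ∷ Ψ) eq = ≡.cong₂ _∷_
        (code-injective φ ψ (injective Treeℕ↣ℕ (inj₂-injective (leaf-injective (proj₁ (·-injective eq))))))
        (list-inj Φ Ψ (proj₂ (·-injective eq)))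

      inj : ∀ {x y} → f x ≡ f y → x ≡ y
      inj {n , α , Φ} {m , β , Ψ} eq with refl ← inj₂-injective (leaf-injective (proj₁ (·-injective eq))) =
        let eq′ = ·-injective (proj₂ (·-injective eq)) in
        cong (n ,_) (≡.cong₂ _,_ (vec-inj α β (proj₁ eq′)) (list-inj Φ Ψ (proj₂ eq′)))

module Back-and-forth
  (em : ∀ ℓ → ExcludedMiddle ℓ)
  (ac : ∀ a ℓ₁ b ℓ₂ r → AxiomOfChoice a ℓ₁ b ℓ₂ r)
  (cov : HasCovMeagre 2^ω)
  {L : Language} (countable : CountableLanguage L)
  where
  open Classical em
  open Cohen em ac cov
  open Models em ac {L}
  open Choice em ac

  abstract
    -- Where earlier tasks agree on the formulas `∃ᶠ χ` for all patterns `χ`, some member of the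
    -- countable set `H` has the pattern of `f k`. A generic choice from the enumeration of `H`
    -- succeeds infinitely often for all contexts at once. `Valid` marks the earlier tasks; contexts
    -- that mention others impose nothing.
    generic-response :
      (M N : Structure L) → let open Structure N using (_≈_) in
      {r : Level} {R : Set r}
      (left : R → ℕ → Structure.Carrier M) (right : R → ℕ → Structure.Carrier N)
      (W : WellOrder) → let open Segments W using (Below) in
      (d : WellOrder.Carrier W) →
      ¬ (2^ω ≤ᶜ ≡.setoid (Below d)) →
      (hist : Below d → R) (Valid : Below d → Set) →
      (∀ {n} (α : Vec (Below d) n) → All Valid α → OftenAgree M N left right (Vec.map hist α)) →
      (H : Pred (Structure.Carrier N) 0ℓ) →
      (∀ {n} φ {ρ : Vec _ n} → All H ρ → Sat N (∃ᶠ φ) ρ → ∃[ y ] (H y × Sat N φ (y ∷ ρ))) →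
      Σ[ c ∈ (ℕ → _) ] ((∀ k → H (c k)) × (∀ {y} → H y → ∃[ v ] c v ≈ y)) →
      (∀ b → Valid b → ∀ k → H (right (hist b) k)) →
      (f : ℕ → Structure.Carrier M) →
      Σ[ g ∈ (ℕ → Structure.Carrier N) ] ((∀ k → H (g k)) ×
        (∀ {n} (α : Vec (Below d) n) → All Valid α → ∀ Φ k₀ → ∃[ k ] (k₀ ℕ.≤ k ×
          Allᴸ (Agree M N (f k ∷ Vec.map (λ r → left r k) (Vec.map hist α))
                          (g k ∷ Vec.map (λ r → right r k) (Vec.map hist α))) Φ)))
    generic-response M N left right W d small hist Valid often H H-closed (c , c∈H , H⊆c) right∈H f =
      (λ k → c (proj₁ generic k)) , (λ k → c∈H _) , λ α α-valid Φ k₀ →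
        let k , k₀≤k , agree = proj₂ generic (_ , α , Φ) k₀ in k , k₀≤k , agree α-valid
      where
      open Segments W using (Below; below-trees)

      Context : Set
      Context = ∃[ n ] Vec (Below d) n × List (Formula L (suc n))

      Response : Context → ℕ → Pred ℕ 0ℓ
      Response (n , α , Φ) k v = All Valid α →
        Allᴸ (Agree M N (f k ∷ Vec.map (λ r → left r k) (Vec.map hist α))
                        (c v ∷ Vec.map (λ r → right r k) (Vec.map hist α))) Φ

      in-hull : ∀ {n} (α : Vec (Below d) n) k → All Valid α → All H (Vec.map (λ r → right r k) (Vec.map hist α))
      in-hull []      k []       = []
      in-hull (b ∷ α) k (v ∷ vs) = right∈H b v k ∷ in-hull α k vs

      respond : ∀ x k₀ → ∃[ k ] (k₀ ℕ.≤ k × ∃ (Response x k))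
      respond (n , α , Φ) k₀ with em _ {All Valid α}
      ... | no ¬valid = k₀ , ℕP.≤-refl , 0 , λ valid → ⊥-elim (¬valid valid)
      ... | yes valid with often α valid (List.map ∃ᶠ_ (patterns Φ)) k₀
      ...   | k , k₀≤k , agree with extend-agreement M N Φ agree (f k)
      ...     | χ , ∃χ , extends with H-closed χ (in-hull α k valid) ∃χ
      ...       | y , y∈H , χ-y with H⊆c y∈H
      ...         | v , cv≈y = k , k₀≤k , v , λ _ → extends (c v) (Sat-resp N χ (N.sym cv≈y ∷ Pointwise.refl N.refl) χ-y)
        where module N = Setoid (Structure.domain N)

      generic : Σ[ g ∈ (ℕ → ℕ) ] (∀ x k₀ → ∃[ k ] (k₀ ℕ.≤ k × Response x k (g k)))
      -- Contexts embed into trees over `Below d ⊎ ℕ`, these into `Below d ⊎ ℕ`, and the summand ℕ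
      -- does not make room for 2^ω.
      generic = cohen-generic
        (λ 2^ω≤ → 2^ω≰⊎ℕ small (injection 2^ω≤ (below-trees d ∘↣ context-code countable)))
        Response respond

-- Stages, schedule and service of the tasks

module Construction
  (em : ∀ ℓ → ExcludedMiddle ℓ)
  (ac : ∀ a ℓ₁ b ℓ₂ r → AxiomOfChoice a ℓ₁ b ℓ₂ r)
  (cov : HasCovMeagre 2^ω)
  {L : Language} (countable : CountableLanguage L)
  (I K : WellOrder)
  where
  open Classical em
  open Models em ac {L}
  open Back-and-forth em ac cov {L} countable

  private
    module I = WellOrder I
    module K = WellOrder K
    module Iˢ = Choice.Segments em ac I
    module Kˢ = Choice.Segments em ac K

  -- `I` stands for ω₁ and `K` for the initial ordinal of 2^ω. `bits` reads a task as a binary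
  -- sequence, `name` codes a rank by one, and `e` is the cofinal sequence.
  module _
    (bits : K.Carrier → ℕ → Bool) (bits-surjective : ∀ (x : ℕ → Bool) → ∃[ t ] (∀ n → bits t n ≡ x n))
    (K-small : ∀ d → ¬ (2^ω ≤ᶜ ≡.setoid (Kˢ.Below d)))
    (name : I.Carrier → ℕ → Bool) (name-injective : ∀ {i j} → (∀ n → name i n ≡ name j n) → i ≡ j)
    (I-bounded : ∀ (s : ℕ → I.Carrier) → ∃[ i ] (∀ k → s k I.< i))
    (I-countable : ∀ i → Σ[ c ∈ (I.Carrier → ℕ) ] (∀ {x y} → x I.< i → y I.< i → c x ≡ c y → x ≡ y))
    (e : I.Carrier → K.Carrier) (e-cofinal : ∀ t → ∃[ i ] t Kˢ.≤ e i)
    (e-bounded : ∀ i → ∃[ d ] (∀ j → j Iˢ.≤ i → e j K.< d))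
    where

    module Filtration (M : Structure L)
                      (rank : Structure.Carrier M → I.Carrier)
                      (rank-injective : ∀ {x y} → rank x ≡ rank y → Structure._≈_ M x y)
                      (m₀ : Structure.Carrier M) where
      open Structure M using (Carrier; _≈_)
      open Skolem countable M m₀ using (Hull; hull-mono; closed; skolem-spec; hull-countable)
      open Skolem countable M m₀ public using (base)
      private module M = Setoid (Structure.domain M)

      -- Including `m₀` keeps every stage nonempty, so that it can be enumerated by ω.
      Generator : I.Carrier → Pred Carrier 0ℓ
      Generator i x = rank x I.< i ⊎ x ≡ m₀

      Stage : I.Carrier → Pred Carrier 0ℓ
      Stage i = Hull (Generator i)

      stage-mono : ∀ {i j} → i Iˢ.≤ j → Stage i ⊆ Stage j
      stage-mono i≤j = hull-mono λ { (inj₁ x<i) → inj₁ (Iˢ.<-≤-trans x<i i≤j) ; (inj₂ eq) → inj₂ eq }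

      stage-closed : ∀ i {n} φ {ρ : Vec Carrier n} → All (Stage i) ρ → Sat M (∃ᶠ φ) ρ →
                     ∃[ y ] (Stage i y × Sat M φ (y ∷ ρ))
      stage-closed i φ ρ∈ h = _ , closed φ ρ∈ , skolem-spec φ h

      stage-countable : ∀ i → Σ[ c ∈ (ℕ → Carrier) ] ((∀ k → Stage i (c k)) × (∀ {x} → Stage i x → ∃[ k ] c k ≈ x))
      stage-countable i = hull-countable enumerate enumerate∈ covers
        where
        number : I.Carrier → ℕ
        number = proj₁ (I-countable i)

        enumerate : ℕ → Carrier
        enumerate zero    = m₀
        enumerate (suc k) = ε (λ x → rank x I.< i × number (rank x) ≡ k) m₀

        enumerate∈ : ∀ k → Generator i (enumerate k)
        enumerate∈ zero    = inj₂ refl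
        enumerate∈ (suc k) = Sum.map₁ proj₁ (ε-default (λ x → rank x I.< i × number (rank x) ≡ k) m₀)

        covers : ∀ {x} → Generator i x → ∃[ k ] enumerate k ≈ x
        covers (inj₂ refl) = 0 , M.refl
        covers {x} (inj₁ x<i) = suc (number (rank x)) ,
          let y<i , eq = ε-spec {P = λ y → rank y I.< i × number (rank y) ≡ number (rank x)} {m₀} (x , x<i , refl)
          in rank-injective (proj₂ (I-countable i) y<i x<i eq)

      -- Bit 0 of t is reserved for telling on which side a sequence lives.
      sequence : K.Carrier → ℕ → Carrier
      sequence t k = ε (λ x → ∀ n → name (rank x) n ≡ bits t (suc (pair k n))) m₀

      sequence-surjective : ∀ b (f : ℕ → Carrier) → ∃[ t ] (bits t 0 ≡ b × (∀ k → sequence t k ≈ f k))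
      sequence-surjective b f =
        let t , t-bits = bits-surjective stream in
        t , t-bits 0 , λ k → rank-injective (name-injective λ n →
          let eq k n = sym (trans (t-bits (suc (pair k n))) (stream-pair k n)) in
          trans (ε-spec {P = λ x → ∀ n → name (rank x) n ≡ bits t (suc (pair k n))} {m₀} (f k , eq k) n) (sym (eq k n)))
        where
        unpair : ℕ → ℕ × ℕ
        unpair n = ε (λ p → to ℕ×ℕ↣ℕ p ≡ n) (0 , 0)

        stream : ℕ → Bool
        stream zero    = b
        stream (suc n) = name (rank (f (proj₁ (unpair n)))) (proj₂ (unpair n))

        stream-pair : ∀ k n → stream (suc (pair k n)) ≡ name (rank (f k)) n
        stream-pair k n = cong (λ p → name (rank (f (proj₁ p))) (proj₂ p))
          (injective ℕ×ℕ↣ℕ (ε-spec {P = λ p → to ℕ×ℕ↣ℕ p ≡ pair k n} ((k , n) , refl)))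

    module _ (M N : Structure L) (M≡N : M ≡ₑ N)
             (rankᴹ : Structure.Carrier M → I.Carrier)
             (rankᴹ-injective : ∀ {x y} → rankᴹ x ≡ rankᴹ y → Structure._≈_ M x y)
             (m₀ : Structure.Carrier M)
             (rankᴺ : Structure.Carrier N → I.Carrier)
             (rankᴺ-injective : ∀ {x y} → rankᴺ x ≡ rankᴺ y → Structure._≈_ N x y)
             (n₀ : Structure.Carrier N)
             where
      private
        module M = Structure M
        module N = Structure N
        module Mᶠ = Filtration M rankᴹ rankᴹ-injective m₀
        module Nᶠ = Filtration N rankᴺ rankᴺ-injective n₀

        -- A task waits until its values, read in either structure, are generators of the stage, and
        -- until its number is bounded by a member of the cofinal sequence that has already been
        -- reached.
        record Timely (t : K.Carrier) (i : I.Carrier) : Set where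
          field
            index   : ∃[ j ] (j Iˢ.≤ i × t Kˢ.≤ e j)
            stageᴹ  : ∀ k → rankᴹ (Mᶠ.sequence t k) I.< i
            stageᴺ  : ∀ k → rankᴺ (Nᶠ.sequence t k) I.< i

        abstract
          timely : ∀ t → ∃ (Timely t)
          timely t with I-bounded (rankᴹ ∘ Mᶠ.sequence t) | I-bounded (rankᴺ ∘ Nᶠ.sequence t) | e-cofinal t
          -- A common strict bound of three elements is obtained as a bound of the sequence i, j, l,
          -- l, l, ...
          ... | i , <i | j , <j | l , t≤el with I-bounded (λ { 0 → i ; 1 → j ; _ → l })
          ...   | m , <m = m , record
            { index  = l , inj₁ (<m 2) , t≤el
            ; stageᴹ = λ k → I.<-trans (<i k) (<m 0)
            ; stageᴺ = λ k → I.<-trans (<j k) (<m 1)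
            }

        time : K.Carrier → I.Carrier
        time t = proj₁ (timely t)

        schedule : K.Carrier ↣ (I.Carrier × K.Carrier)
        schedule = mk↣ {to = λ t → time t , t} (cong proj₂)

        order : WellOrder
        order = pullback (I ×ₗ K) schedule

        open WellOrder order using () renaming (_<_ to _≺_)

        time-mono : ∀ {s t} → s ≺ t → time s Iˢ.≤ time t
        time-mono (inj₁ lt)       = inj₁ lt
        time-mono (inj₂ (eq , _)) = inj₂ eq

        bound : K.Carrier → K.Carrier
        bound t = proj₁ (e-bounded (time t))

        -- Here the cofinality enters: the number of `s` is at most some `e j` with `j` up to the
        -- stage of `t`, and all these `e j` have one strict bound in `K`. So fewer than 2^ω tasks
        -- precede `t`.
        ≺-bound : ∀ {s t} → s ≺ t → s K.< bound t
        ≺-bound {s} {t} s≺t =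
          let j , j≤ , s≤ej = Timely.index (proj₂ (timely s)) in
          Kˢ.≤-<-trans s≤ej (proj₂ (e-bounded (time t)) j (Iˢ.≤-trans j≤ (time-mono {s} {t} s≺t)))

        R : Set
        R = (ℕ → M.Carrier) × (ℕ → N.Carrier)

        left : R → ℕ → M.Carrier
        left = proj₁

        right : R → ℕ → N.Carrier
        right = proj₂

        record Serves (t : K.Carrier) (r : R) : Set where
          field
            servesᴹ : bits t 0 ≡ true → left r ≡ Mᶠ.sequence t
            servesᴺ : bits t 0 ≡ false → right r ≡ Nᶠ.sequence t
            leftᴹ   : ∀ k → Mᶠ.Stage (time t) (left r k)
            rightᴺ  : ∀ k → Nᶠ.Stage (time t) (right r k)

        -- A vector of earlier tasks is a vector over a set of fewer than 2^ω tasks.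
        confine : ∀ {t n} (α : Vec K.Carrier n) → All (_≺ t) α →
                  Σ[ β ∈ Vec (Kˢ.Below (bound t)) n ] (All (λ b → proj₁ b ≺ t) β × Vec.map proj₁ β ≡ α)
        confine []      []        = [] , [] , refl
        confine {t} (s ∷ α) (s≺t ∷ α≺t) =
          let β , β≺t , eq = confine α α≺t in
          (s , ∣ ≺-bound {s} {t} s≺t ∣⁺) ∷ β , s≺t ∷ β≺t , cong (s ∷_) eq

        abstract
          -- Bit 0 decides which half of the pair is dictated by the task. The other half is a
          -- generic response inside the countable stage, which contains all earlier values because
          -- stages increase.
          serve : ∀ t (h : K.Carrier → R) → (∀ {s} → s ≺ t → Serves s (h s)) →
                  (∀ {n} (α : Vec K.Carrier n) → All (_≺ t) α → OftenAgree M N left right (Vec.map h α)) →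
                  ∃[ r ] (Serves t r × (∀ {n} (α : Vec K.Carrier n) → All (_≺ t) α →
                    OftenAgree M N left right (r ∷ Vec.map h α)))
          serve t h served often = by-side (bits t 0) refl
            where
            history : Kˢ.Below (bound t) → R
            history = h ∘ proj₁

            Valid : Kˢ.Below (bound t) → Set
            Valid b = proj₁ b ≺ t

            often′ : ∀ {n} (β : Vec (Kˢ.Below (bound t)) n) → All Valid β → OftenAgree M N left right (Vec.map history β)
            often′ β β≺t = subst (OftenAgree M N left right) (sym (map-∘ h proj₁ β)) (often (Vec.map proj₁ β) (AllP.map⁺ β≺t))

            unconfine : ∀ r → (∀ {n} (β : Vec (Kˢ.Below (bound t)) n) → All Valid β →
                                OftenAgree M N left right (r ∷ Vec.map history β)) →
                        ∀ {n} (α : Vec K.Carrier n) → All (_≺ t) α → OftenAgree M N left right (r ∷ Vec.map h α)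
            unconfine r often α α≺t with confine α α≺t
            ... | β , β≺t , refl = subst (λ ρ → OftenAgree M N left right (r ∷ ρ)) (map-∘ h proj₁ β) (often β β≺t)

            by-side : ∀ b → bits t 0 ≡ b → ∃[ r ] (Serves t r × (∀ {n} (α : Vec K.Carrier n) → All (_≺ t) α →
                    OftenAgree M N left right (r ∷ Vec.map h α)))
            by-side true eq
              with generic-response M N left right K (bound t) (K-small _) history Valid often′
                     (Nᶠ.Stage (time t)) (Nᶠ.stage-closed (time t)) (Nᶠ.stage-countable (time t))
                     (λ (s , _) s≺t k → Nᶠ.stage-mono (time-mono {s} {t} s≺t) (Serves.rightᴺ (served s≺t) k))
                     (Mᶠ.sequence t)
            ... | g , g∈ , agrees = (Mᶠ.sequence t , g) , record
              { servesᴹ = λ _ → refl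
              ; servesᴺ = λ eq′ → contradiction (trans (sym eq) eq′) λ ()
              ; leftᴹ   = λ k → Mᶠ.base (inj₁ (Timely.stageᴹ (proj₂ (timely t)) k))
              ; rightᴺ  = g∈
              } , unconfine _ λ β → agrees β
            by-side false eq
              with generic-response N M right left K (bound t) (K-small _) history Valid
                     (λ β β≺t → OftenAgree-sym M N left right (Vec.map history β) (often′ β β≺t))
                     (Mᶠ.Stage (time t)) (Mᶠ.stage-closed (time t)) (Mᶠ.stage-countable (time t))
                     (λ (s , _) s≺t k → Mᶠ.stage-mono (time-mono {s} {t} s≺t) (Serves.leftᴹ (served s≺t) k))
                     (Nᶠ.sequence t)
            ... | g , g∈ , agrees = (g , Nᶠ.sequence t) , record
              { servesᴹ = λ eq′ → contradiction (trans (sym eq′) eq) λ ()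
              ; servesᴺ = λ _ → refl
              ; leftᴹ   = g∈
              ; rightᴺ  = λ k → Nᶠ.base (inj₁ (Timely.stageᴺ (proj₂ (timely t)) k))
              } , unconfine _ λ β β≺t → OftenAgree-sym N M right left (_ ∷ Vec.map history β) (agrees β β≺t)

          play : Σ[ h ∈ (K.Carrier → R) ] ((∀ t → Serves t (h t)) ×
                   (∀ {n} (α : Vec K.Carrier n) → OftenAgree M N left right (Vec.map h α)))
          play = FiniteCharacter.coherent em ac order ((λ _ → m₀) , (λ _ → n₀)) Serves
            (OftenAgree M N left right) (OftenAgree-rename M N left right)
            -- For the empty tuple, agreement is elementary equivalence and holds at every
            -- coordinate.
            (λ Φ k₀ → k₀ , ℕP.≤-refl , ListAll.universal M≡N Φ) serve

        leftᵗ : K.Carrier → ℕ → M.Carrier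
        leftᵗ t = left (proj₁ play t)

        rightᵗ : K.Carrier → ℕ → N.Carrier
        rightᵗ t = right (proj₁ play t)

        Condition : Set
        Condition = ∃[ n ] Vec K.Carrier n × List (Formula L n)

        Agreement : Condition → Pred ℕ 0ℓ
        Agreement (n , α , Φ) k = AgreeAt M N leftᵗ rightᵗ k α Φ

        agreement-nonempty : ∀ b → ∃ (Agreement b)
        agreement-nonempty (n , α , Φ) =
          let k , _ , agree = proj₂ (proj₂ play) α Φ 0 in
          k , ≡.subst₂ (λ ρ ρ′ → Allᴸ (Agree M N ρ ρ′) Φ) (sym (map-∘ _ _ α)) (sym (map-∘ _ _ α)) agree

        agreement-directed : ∀ b c → ∃[ d ] (Agreement d ⊆ Agreement b × Agreement d ⊆ Agreement c)
        agreement-directed (m , α , Φ) (n , β , Ψ) =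
          (m ℕ.+ n , α ++ β , List.map (rename (_↑ˡ n)) Φ List.++ List.map (rename (m ↑ʳ_)) Ψ) ,
          (λ {k} agree → AgreeAt-rename M N leftᵗ rightᵗ (_↑ˡ n) α (α ++ β) (lookup-++ˡ α β) Φ
            (ListAllP.++⁻ˡ (List.map (rename (_↑ˡ n)) Φ) agree)) ,
          (λ {k} agree → AgreeAt-rename M N leftᵗ rightᵗ (m ↑ʳ_) β (α ++ β) (lookup-++ʳ α β) Ψ
            (ListAllP.++⁻ʳ (List.map (rename (_↑ˡ n)) Φ) agree))

      isomorphic-ultrapowers : Σ[ 𝓤 ∈ Ultrafilter ℕ ] (ultrapower M 𝓤 ≃ ultrapower N 𝓤)
      isomorphic-ultrapowers
        -- `K`, read through `bits`, now lists the subsets of ω instead of the tasks.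
        with FiniteCharacter.extend-to-ultrafilter em ac K bits bits-surjective Agreement (0 , [] , [])
               agreement-nonempty agreement-directed
      ... | 𝓤 , large = 𝓤 , Transfer.ultrapowers-isomorphic M N 𝓤 leftᵗ rightᵗ
        (λ α φ → Ultrafilter.upward 𝓤 ListAll.head (large (_ , α , φ ∷ [])))
        (λ f → let t , eq , seq≈f = Mᶠ.sequence-surjective true f in
          t , λ k → subst (λ s → s k M.≈ f k) (sym (Serves.servesᴹ (proj₁ (proj₂ play) t) eq)) (seq≈f k))
        (λ g → let t , eq , seq≈g = Nᶠ.sequence-surjective false g in
          t , λ k → subst (λ s → s k N.≈ g k) (sym (Serves.servesᴺ (proj₁ (proj₂ play) t) eq)) (seq≈g k))

-- Ordinals

module Ordinals (em : ∀ ℓ → ExcludedMiddle ℓ)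
                (ac : ∀ a ℓ₁ b ℓ₂ r → AxiomOfChoice a ℓ₁ b ℓ₂ r) where
  open Classical em
  open Choice em ac

  module Canonical (α : Ordinal) where
    private
      module α = Ordinal α
      module O = StrictTotalOrder α.strictTotalOrder
      module E = Setoid ∣ α ∣

      rep : α.Carrier → α.Carrier
      rep = proj₁ (representatives ∣ α ∣)

    -- One representative of each class. Uniqueness of identity proofs makes the second component
    -- irrelevant, so setoid equality becomes propositional.
    Canon : Set
    Canon = Σ[ x ∈ α.Carrier ] rep x ≡ x

    ≈⇒≡ : {x y : Canon} → proj₁ x α.≈ proj₁ y → x ≡ y
    ≈⇒≡ {x , px} {y , py} x≈y with refl ← trans (sym px) (trans (proj₁ (proj₂ (representatives ∣ α ∣)) x≈y) py) =
      cong (x ,_) (≡-irrelevant px py)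

    canon : α.Carrier → Canon
    canon x = rep x , sym (proj₁ (proj₂ (representatives ∣ α ∣)) (proj₂ (proj₂ (representatives ∣ α ∣)) x))

    canon-≈ : ∀ x → x α.≈ proj₁ (canon x)
    canon-≈ = proj₂ (proj₂ (representatives ∣ α ∣))

    canon-cong : ∀ {x y} → x α.≈ y → canon x ≡ canon y
    canon-cong x≈y = ≈⇒≡ (E.trans (E.sym (canon-≈ _)) (E.trans x≈y (canon-≈ _)))

    canon-injective : ∀ {x y} → canon x ≡ canon y → x α.≈ y
    canon-injective {x} {y} eq = E.trans (canon-≈ x) (E.trans (E.reflexive (cong proj₁ eq)) (E.sym (canon-≈ y)))

    wellOrder : WellOrder
    wellOrder = record
      { Carrier     = Canon
      ; _<_         = α._<_ on proj₁
      ; wellFounded = On.wellFounded proj₁ α.wellFounded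
      ; <-trans     = O.trans
      ; compare     = compare
      }
      where
      compare : Trichotomous _≡_ (α._<_ on proj₁)
      compare x y with O.compare (proj₁ x) (proj₁ y)
      ... | tri< a ¬b ¬c = tri< a (λ { refl → ¬b E.refl }) ¬c
      ... | tri≈ ¬a b ¬c = tri≈ ¬a (≈⇒≡ b) ¬c
      ... | tri> ¬a ¬b c = tri> ¬a (λ { refl → ¬b E.refl }) c

  module Omega₁ (ω₁ : Ordinal) (isω₁ : IsOmega₁ ω₁) where
    open Canonical ω₁
    open WellOrder wellOrder
    open Segments wellOrder using (_≤_)

    element : Ordinal.Carrier ω₁
    element = by-contradiction λ empty → proj₁ isω₁ (record
      { to = λ x → ⊥-elim (empty x) ; cong = λ {x} → ⊥-elim (empty x) ; injective = λ {x} → ⊥-elim (empty x) })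

    -- The number 0 is kept for `i` itself, so that the closed segment up to `i` is numbered
    -- injectively.
    number : ∀ i x → Dec (x < i) → ℕ
    number i x (yes x<i) = suc (Injection.to (proj₂ isω₁ (proj₁ i)) (proj₁ x , x<i))
    number i x (no _)    = 0

    number-injective : ∀ i {x y} p q → x ≤ i → y ≤ i → number i x p ≡ number i y q → x ≡ y
    number-injective i (yes _) (yes _) _ _ eq = ≈⇒≡ (Injection.injective (proj₂ isω₁ (proj₁ i)) (ℕP.suc-injective eq))
    number-injective i (no ¬p) _ (inj₁ p) _ _ = ⊥-elim (¬p p)
    number-injective i _ (no ¬q) _ (inj₁ q) _ = ⊥-elim (¬q q)
    number-injective i (no _) (no _) (inj₂ refl) (inj₂ refl) _ = refl

    segments-countable : ∀ i → Σ[ c ∈ (Carrier → ℕ) ] (∀ {x y} → x ≤ i → y ≤ i → c x ≡ c y → x ≡ y)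
    segments-countable i = (λ x → number i x (em _)) , number-injective i (em _) (em _)

    uncountable : ¬ (Carrier ↣ ℕ)
    uncountable f = proj₁ isω₁ (record
      { to        = to f ∘ canon
      ; cong      = λ x≈y → cong (to f) (canon-cong x≈y)
      ; injective = λ eq → canon-injective (injective f eq)
      })

    -- Regularity of ω₁: an unbounded sequence would present it as a countable union of countable
    -- segments, and the pair of index and label would number it by ω.
    bounded : ∀ (s : ℕ → Carrier) → ∃[ i ] (∀ k → s k < i)
    bounded s = by-contradiction λ unbounded →
      let reached : ∀ i → ∃[ k ] i ≤ s k
          reached i = let k , s≮i = ¬∀⇒∃¬ (λ s<i → unbounded (i , s<i)) in k , ≮⇒≥ s≮i
          index i   = proj₁ (reached i)
          label i   = proj₁ (segments-countable (s (index i))) i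
      in uncountable (mk↣ {to = λ i → pair (index i) (label i)} λ {i} {j} eq →
        let k≡l , eq′ = pair-injective (index i) (label i) (index j) (label j) eq in
        same i j (reached i) (reached j) k≡l eq′)
      where
      ≮⇒≥ : ∀ {x y} → ¬ (x < y) → y ≤ x
      ≮⇒≥ {x} {y} x≮y with compare x y
      ... | tri< x<y _ _ = ⊥-elim (x≮y x<y)
      ... | tri≈ _ x≡y _ = inj₂ (sym x≡y)
      ... | tri> _ _ y<x = inj₁ y<x

      same : ∀ i j (p : ∃[ k ] i ≤ s k) (q : ∃[ k ] j ≤ s k) → proj₁ p ≡ proj₁ q →
             proj₁ (segments-countable (s (proj₁ p))) i ≡ proj₁ (segments-countable (s (proj₁ q))) j → i ≡ j
      same i j (k , i≤) (.k , j≤) refl eq = proj₂ (segments-countable (s k)) i≤ j≤ eq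

    module Cofinality (κ : Ordinal) (cofinality : IsMinSize ⟪_⟫ (Ordinal.Cofinal κ) ∣ ω₁ ∣) where
      private
        module κ = Ordinal κ
        module E = Setoid ∣ κ ∣
        module C = Canonical κ
        module Kᵂ = WellOrder C.wellOrder
        module Kˢ = Segments C.wellOrder

        A : Subset ∣ κ ∣
        A = proj₁ (proj₁ cofinality)

        A-cofinal : κ.Cofinal A
        A-cofinal = proj₁ (proj₂ (proj₁ cofinality))

        module B = Bijection (proj₂ (proj₂ (proj₁ cofinality)))

      sequence : Carrier → Kᵂ.Carrier
      sequence i = C.canon (proj₁ (proj₁ (B.surjective (proj₁ i))))

      sequence-cofinal : ∀ t → ∃[ i ] t Kˢ.≤ sequence i
      sequence-cofinal t with A-cofinal (proj₁ t)
      ... | y , y∈A , t≤y = i , t≤ t≤y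
        where
        i : Carrier
        i = canon (B.to (y , y∈A))

        y≈ : y κ.≈ proj₁ (sequence i)
        y≈ = E.trans (B.injective (Setoid.trans ∣ ω₁ ∣ (canon-≈ _)
               (Setoid.sym ∣ ω₁ ∣ (proj₂ (B.surjective (proj₁ i)) {proj₁ (B.surjective (proj₁ i))} E.refl))))
               (C.canon-≈ _)

        t≤ : proj₁ t κ.< y ⊎ proj₁ t κ.≈ y → t Kˢ.≤ sequence i
        t≤ (inj₁ t<y) = inj₁ (StrictTotalOrder.<-respʳ-≈ κ.strictTotalOrder y≈ t<y)
        t≤ (inj₂ t≈y) = inj₂ (C.≈⇒≡ (E.trans t≈y y≈))

      -- Otherwise the members with index up to `i` would form a countable cofinal set, although
      -- every cofinal set has at least ℵ₁ elements.
      sequence-bounded : ∀ i → ∃[ d ] (∀ j → j ≤ i → sequence j Kᵂ.< d)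
      sequence-bounded i = by-contradiction λ unbounded →
        proj₁ isω₁ (injection (proj₂ cofinality values (cofinal unbounded)) countable)
        where
        values : Subset ∣ κ ∣
        values = record
          { Mem  = λ x → ∃[ j ] (j ≤ i × x κ.≈ proj₁ (sequence j))
          ; resp = λ { x≈y (j , j≤i , x≈) → j , j≤i , E.trans (E.sym x≈y) x≈ }
          }

        cofinal : ¬ (∃[ d ] (∀ j → j ≤ i → sequence j Kᵂ.< d)) → κ.Cofinal values
        cofinal unbounded x with ¬∀⇒∃¬ (λ s<d → unbounded (C.canon x , s<d))
        ... | j , ¬< with ¬∀⇒∃¬ ¬<
        ...   | j≤i , sj≮ = proj₁ (sequence j) , (j , j≤i , E.refl) , x≤ (Kᵂ.compare (sequence j) (C.canon x))
          where
          x≤ : Tri (sequence j Kᵂ.< C.canon x) (sequence j ≡ C.canon x) (C.canon x Kᵂ.< sequence j) →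
               x κ.< proj₁ (sequence j) ⊎ x κ.≈ proj₁ (sequence j)
          x≤ (tri< s< _ _) = ⊥-elim (sj≮ s<)
          x≤ (tri≈ _ eq _) = inj₂ (E.trans (C.canon-≈ x) (E.reflexive (cong proj₁ (sym eq))))
          x≤ (tri> _ _ <s) = inj₁ (κ.<-respˡ-≈ (E.sym (C.canon-≈ x)) <s)

        -- An index of the value `x`, selected by `ε` and not by minimality; `canon` makes the
        -- selection depend only on the class of `x`.
        least : κ.Carrier → Carrier
        least x = ε (λ j → j ≤ i × proj₁ (C.canon x) κ.≈ proj₁ (sequence j)) i

        least-spec : ∀ {x} → Mem values x → least x ≤ i × proj₁ (C.canon x) κ.≈ proj₁ (sequence (least x))
        least-spec {x} (j , j≤i , x≈) = ε-spec {P = λ j → j ≤ i × proj₁ (C.canon x) κ.≈ proj₁ (sequence j)}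
          (j , j≤i , E.trans (E.sym (C.canon-≈ x)) x≈)

        countable : Countable ⟪ values ⟫
        countable = record
          { to        = λ (x , _) → proj₁ (segments-countable i) (least x)
          ; cong      = λ x≈y → cong
                          (λ z → proj₁ (segments-countable i) (ε (λ j → j ≤ i × proj₁ z κ.≈ proj₁ (sequence j)) i))
                          (C.canon-cong x≈y)
          ; injective = λ {(x , x∈)} {(y , y∈)} eq →
              let p , x≈ = least-spec x∈ ; q , y≈ = least-spec y∈
                  same   = proj₂ (segments-countable i) p q eq
              in E.trans (C.canon-≈ x) (E.trans x≈ (E.trans (E.reflexive (cong (proj₁ ∘ sequence) same))
                   (E.trans (E.sym y≈) (E.sym (C.canon-≈ y)))))
          }

theorem1p2 :
    (∀ ℓ → ExcludedMiddle ℓ) →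
    (∀ a ℓ₁ b ℓ₂ r → AxiomOfChoice a ℓ₁ b ℓ₂ r) →
    (ω₁ : Ordinal) → IsOmega₁ ω₁ →
    ∣ ω₁ ∣ <ᶜ 2^ω →
    HasCofinality 2^ω ∣ ω₁ ∣ →
    HasCovMeagre 2^ω →
    (L : Language) → CountableLanguage L →
    (M N : Structure L) →
    Structure.domain M ≈ᶜ ∣ ω₁ ∣ →
    Structure.domain N ≈ᶜ ∣ ω₁ ∣ →
    M ≡ₑ N →
    Σ[ 𝓤 ∈ Ultrafilter ℕ ] (ultrapower M 𝓤 ≃ ultrapower N 𝓤)
theorem1p2 em ac ω₁ isω₁ (ω₁≤2^ω , _) (κ , (κ≈2^ω , κ-initial) , cofinality) cov L countable M N M≈ω₁ N≈ω₁ M≡N =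
  Construction.isomorphic-ultrapowers em ac cov {L} countable I.wellOrder K.wellOrder
    (λ t → Bijection.to κ≈2^ω (proj₁ t))
    (λ x → let y , hits = Bijection.surjective κ≈2^ω x in
      K.canon y , hits (Setoid.sym ∣ κ ∣ (K.canon-≈ y)))
    -- Since κ has size 2^ω, an embedding of 2^ω into a proper segment would embed κ there, but κ is
    -- initial.
    (λ d 2^ω≤ → proj₂ (κ-initial (proj₁ d))
      (injection (Bijection.injection κ≈2^ω) (injection 2^ω≤ (record
        { to        = λ (x , x<d) → proj₁ x , ∣ x<d ∣⁻
        ; cong      = λ { refl → Setoid.refl ∣ κ ∣ }
        ; injective = λ x≈y → Sub-≡ (K.≈⇒≡ x≈y)
        }))))
    (λ i → Injection.to ω₁≤2^ω (proj₁ i))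
    (λ eq → I.≈⇒≡ (Injection.injective ω₁≤2^ω eq))
    W.bounded
    (λ i → proj₁ (W.segments-countable i) , λ x<i y<i → proj₂ (W.segments-countable i) (inj₁ x<i) (inj₁ y<i))
    C.sequence C.sequence-cofinal C.sequence-bounded
    M N M≡N
    (I.canon ∘ Bijection.to M≈ω₁)
    (λ eq → Bijection.injective M≈ω₁ (I.canon-injective eq))
    (proj₁ (Bijection.surjective M≈ω₁ W.element))
    (I.canon ∘ Bijection.to N≈ω₁)
    (λ eq → Bijection.injective N≈ω₁ (I.canon-injective eq))
    (proj₁ (Bijection.surjective N≈ω₁ W.element))
  where
  open Classical em
  open Ordinals em ac
  module I = Canonical ω₁
  module K = Canonical κ
  module W = Omega₁ ω₁ isω₁
  module C = W.Cofinality κ cofinality
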